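{- Let $d \geq 0$ and $r \geq 2$ be integers. If $G$ is a graph of maximum degree at most $d$ satisfying $\chi(G) \leq r$, then \[\chi_P(G) \leq AT(G) \leq \left(1 - \frac{1}{4r+1}\right) d + 2.\]
   Context: All graphs are finite and simple. $\chi(G)$ is the chromatic number. Paintability: given $f:V(G)\to\mathbb N$, in the $f$-painting game each vertex $v$ starts with $f(v)$ tokens. On each turn $i$, Lister removes at most one token from each vertex, letting $S_i$ be the (nonempty) set of vertices that lost a token; Painter then colors an independent subset of $S_i$ with color $i$ (a vertex once colored stays colored). The game ends when all tokens are gone; Painter wins if every vertex has been colored. $G$ is $f$-paintable if Painter has a winning strategy; $\chi_P(G)$ is the minimum $k$ such that $G$ is $f$-paintable for the constant function $f\equiv k$. Alon–Tarsi number: for an orientation $\vec G$ of $G$, a spanning subgraph $\vec H$ (same vertex set) is Eulerian if $\deg^+_{\vec H}(v)=\deg^-_{\vec H}(v)$ for all $v$; it is even or odd according to the parity of $|E(\vec H)|$. Let $EE(\vec G)$, $EO(\vec G)$ be the numbers of even and odd Eulerian subgraphs. $\vec G$ is an Alon–Tarsi orientation if $EE(\vec G)\neq EO(\vec G)$. $AT(G)$ is the minimum $k$ such that $G$ has an Alon–Tarsi orientation with $\deg^+(v) < k$ for every vertex $v$. -}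

module Defs where

open import Data.Bool.Base using (true; false; if_then_else_)
open import Data.Fin.Base using (Fin; zero; suc) renaming (_<_ to _<ᶠ_)
open import Data.Fin.Induction using () renaming (<-wellFounded to <ᶠ-wellFounded)
open import Data.Fin.Properties using (all?; any?; <-cmp)
  renaming (_<?_ to _<ᶠ?_; _≟_ to _≟ᶠ_)
open import Data.Fin.Subset
  using (Subset; inside; outside; _∈_; _∉_; _⊆_; _∪_; ∣_∣; ⁅_⁆; ⊥; Nonempty)
open import Data.Fin.Subset.Properties
  using ( _∈?_; _⊆?_; nonempty?; anySubset?; ∉⊥; ∈⊤; ∣⊥∣≡0; ∣p∣≤n; ∣p∣≡n⇒p≡⊤; ⊥⊆
        ; x∈⁅x⁆; x∈⁅y⁆⇒x≡y; p⊆p∪q; q⊆p∪q; p⊆q⇒∣p∣≤∣q∣; p⊂q⇒∣p∣<∣q∣; Empty-unique)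
open import Data.List.Base as List using (List; []; _∷_; cartesianProductWith; filter; length; allFin)
open import Data.List.Extrema.Nat using (max)
open import Data.List.Membership.Propositional using (find; lose) renaming (_∈_ to _∈ˡ_)
open import Data.List.Membership.Propositional.Properties
  using (∈-cartesianProductWith⁺; ∈-allFin; ∈-filter⁺)
open import Data.List.Relation.Unary.All as All using ([]; _∷_)
open import Data.List.Relation.Unary.AllPairs using ([]; _∷_)
open import Data.List.Relation.Unary.Any as Any using (here; there)
open import Data.List.Relation.Unary.Unique.Propositional using (Unique)
open import Data.List.Relation.Unary.Unique.Propositional.Properties using (cartesianProductWith⁺)
open import Data.List.Properties using (filter-none)
open import Data.Nat.Base using (ℕ; zero; suc; _+_; _≤_; _<_; z≤n; s≤s; pred)
open import Data.Nat.Divisibility using (_∣_; _∣?_; _∣0)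
open import Data.Nat.Properties as ℕ using (_≟_; _<?_)
open import Data.Product.Base using (Σ; ∃; _×_; _,_; proj₁; proj₂)
open import Data.Sum.Base using (_⊎_; inj₁; inj₂)
open import Data.Vec.Base as Vec using (Vec; []; _∷_; lookup; tabulate; replicate)
open import Data.Vec.Properties
  using (∷-injective; lookup∘tabulate; lookup-map; lookup-replicate; []=⇒lookup; lookup⇒[]=)
open import Function.Base using (_∘_; const; id)
open import Induction.WellFounded using (Acc; acc)
open import Level using (0ℓ)
open import Relation.Binary.Core using (Rel)
open import Relation.Binary.Definitions
  using (Decidable; Symmetric; Irreflexive; tri<; tri≈; tri>)
open import Relation.Binary.PropositionalEquality
  using (_≡_; _≢_; refl; sym; trans; cong; cong₂; subst)
open import Relation.Nullary.Decidable
  using (Dec; yes; no; does; map′; ¬?; _×-dec_; _⊎-dec_; _→-dec_; decidable-stable; dec-true)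
open import Relation.Nullary.Negation using (¬_; contradiction)

IsLeast : (ℕ → Set) → ℕ → Set
IsLeast P k = P k × (∀ j → P j → k ≤ j)

least : {P : ℕ → Set} → (∀ k → Dec (P k)) → ∀ b → P b → ∃ (IsLeast P)
least P? zero    p = 0 , p , λ _ _ → z≤n
least P? (suc b) p with P? 0
... | yes p₀ = 0 , p₀ , λ _ _ → z≤n
... | no ¬p₀ with least (P? ∘ suc) b p
...   | k , pk , k-least = suc k , pk , λ
  { zero    p₀ → contradiction p₀ ¬p₀
  ; (suc j) pj → s≤s (k-least j pj)
  }

allVecs : {A : Set} → List A → ∀ n → List (Vec A n)
allVecs xs zero    = [] ∷ []
allVecs xs (suc n) = cartesianProductWith _∷_ xs (allVecs xs n)

∈-allVecs : {A : Set} {xs : List A} → (∀ x → x ∈ˡ xs) →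
            ∀ {n} (v : Vec A n) → v ∈ˡ allVecs xs n
∈-allVecs full []      = here refl
∈-allVecs full (x ∷ v) = ∈-cartesianProductWith⁺ _∷_ (full x) (∈-allVecs full v)

allVecs-unique : {A : Set} {xs : List A} → Unique xs → ∀ n → Unique (allVecs xs n)
allVecs-unique uniq zero    = [] ∷ []
allVecs-unique uniq (suc n) =
  cartesianProductWith⁺ _∷_ ∷-injective uniq (allVecs-unique uniq n)

dec-∃ : {A : Set} {xs : List A} → (∀ x → x ∈ˡ xs) →
        {P : A → Set} → (∀ x → Dec (P x)) → Dec (∃ P)
dec-∃ {xs = xs} full P? =
  map′ (λ p → let x , _ , px = find p in x , px)
       (λ (x , px) → lose (full x) px)
       (Any.any? P? xs)

dec-∀-Subset : ∀ {n} {P : Subset n → Set} → (∀ S → Dec (P S)) → Dec (∀ S → P S)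
dec-∀-Subset P? = map′
  (λ ¬∃¬ S → decidable-stable (P? S) (λ ¬p → ¬∃¬ (S , ¬p)))
  (λ ∀P (S , ¬p) → ¬p (∀P S))
  (¬? (anySubset? (¬? ∘ P?)))

-- Finite simple graphs, with the vertex set enumerated as Fin n.

record Graph (n : ℕ) : Set₁ where
  field
    Adj         : Rel (Fin n) 0ℓ
    adj?        : Decidable Adj
    symmetric   : Symmetric Adj
    irreflexive : Irreflexive _≡_ Adj

  neighbours : Fin n → Subset n
  neighbours v = tabulate (λ u → does (adj? v u))

  degree : Fin n → ℕ
  degree v = ∣ neighbours v ∣

  maxDegree : ℕ
  maxDegree = max 0 (List.map degree (allFin n))

  Independent : Subset n → Set
  Independent T = ∀ u v → u ∈ T → v ∈ T → ¬ Adj u v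

  independent? : ∀ T → Dec (Independent T)
  independent? T = all? λ u → all? λ v →
    (u ∈? T) →-dec ((v ∈? T) →-dec ¬? (adj? u v))

open Graph public

module _ {n : ℕ} (G : Graph n) where

  Proper : ∀ {k} → (Fin n → Fin k) → Set
  Proper c = ∀ u v → Adj G u v → c u ≢ c v

  Colourable : ℕ → Set
  Colourable k = Σ (Fin n → Fin k) Proper

  colourable? : ∀ k → Dec (Colourable k)
  colourable? k = map′
    (λ (c , pr) → lookup c , pr)
    (λ (c , pr) → tabulate c , λ u v uv eq →
       pr u v uv (trans (sym (lookup∘tabulate c u)) (trans eq (lookup∘tabulate c v))))
    (dec-∃ (∈-allVecs ∈-allFin) λ c →
       all? λ u → all? λ v → adj? G u v →-dec ¬? (lookup c u ≟ᶠ lookup c v))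

  colourable-n : Colourable n
  colourable-n = id , λ u v uv u≡v → irreflexive G u≡v uv

  χ-least : ∃ (IsLeast Colourable)
  χ-least = least colourable? n colourable-n

  χ : ℕ
  χ = proj₁ χ-least

-- A digraph is the vector of its out-neighbourhoods.

Digraph : ℕ → Set
Digraph n = Vec (Subset n) n

module _ {n : ℕ} where

  Arc : Digraph n → Fin n → Fin n → Set
  Arc D u v = v ∈ lookup D u

  outDegree : Digraph n → Fin n → ℕ
  outDegree D v = ∣ lookup D v ∣

  inNeighbours : Digraph n → Fin n → Subset n
  inNeighbours D v = Vec.map (λ out → lookup out v) D

  inDegree : Digraph n → Fin n → ℕ
  inDegree D v = ∣ inNeighbours D v ∣

  size : Digraph n → ℕ
  size D = Vec.sum (Vec.map ∣_∣ D)

  SpanningSubgraph : Digraph n → Digraph n → Set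
  SpanningSubgraph D H = ∀ v → lookup H v ⊆ lookup D v

  EulerianSubgraph : Digraph n → Digraph n → Set
  EulerianSubgraph D H = SpanningSubgraph D H × (∀ v → outDegree H v ≡ inDegree H v)

  eulerian? : ∀ D H → Dec (EulerianSubgraph D H)
  eulerian? D H = all? (λ v → lookup H v ⊆? lookup D v)
            ×-dec all? (λ v → outDegree H v ≟ inDegree H v)

  EvenEulerian OddEulerian : Digraph n → Digraph n → Set
  EvenEulerian D H = EulerianSubgraph D H × 2 ∣ size H
  OddEulerian  D H = EulerianSubgraph D H × ¬ (2 ∣ size H)

  evenEulerian? : ∀ D H → Dec (EvenEulerian D H)
  evenEulerian? D H = eulerian? D H ×-dec (2 ∣? size H)

  oddEulerian? : ∀ D H → Dec (OddEulerian D H)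
  oddEulerian? D H = eulerian? D H ×-dec ¬? (2 ∣? size H)

allSubsets : ∀ n → List (Subset n)
allSubsets n = allVecs (outside ∷ inside ∷ []) n

allDigraphs : ∀ n → List (Digraph n)
allDigraphs n = allVecs (allSubsets n) n

∈-allDigraphs : ∀ {n} (D : Digraph n) → D ∈ˡ allDigraphs n
∈-allDigraphs = ∈-allVecs (∈-allVecs λ { outside → here refl ; inside → there (here refl) })

allDigraphs-unique : ∀ n → Unique (allDigraphs n)
allDigraphs-unique n =
  allVecs-unique (allVecs-unique (((λ ()) ∷ []) ∷ [] ∷ []) n) n

-- Every digraph on Fin n occurs exactly once in allDigraphs n, so these
-- lengths are the numbers of even and odd Eulerian subgraphs.

EE EO : ∀ {n} → Digraph n → ℕ
EE D = length (filter (evenEulerian? D) (allDigraphs _))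
EO D = length (filter (oddEulerian? D) (allDigraphs _))

module _ {n : ℕ} (G : Graph n) where

  record IsOrientation (D : Digraph n) : Set where
    constructor orientation
    field
      arc⇒adj    : ∀ u v → Arc D u v → Adj G u v
      adj⇒arc    : ∀ u v → Adj G u v → Arc D u v ⊎ Arc D v u
      asymmetric : ∀ u v → Arc D u v → ¬ Arc D v u

  AlonTarsiOrientation : Digraph n → Set
  AlonTarsiOrientation D = IsOrientation D × EE D ≢ EO D

  HasATOrientation : ℕ → Set
  HasATOrientation k =
    ∃ λ D → AlonTarsiOrientation D × (∀ v → outDegree D v < k)

  isOrientation? : ∀ D → Dec (IsOrientation D)
  isOrientation? D = map′ (λ (a , b , c) → orientation a b c)
                          (λ (orientation a b c) → a , b , c)
    (     all? (λ u → all? λ v → arc? u v →-dec adj? G u v)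
    ×-dec all? (λ u → all? λ v → adj? G u v →-dec (arc? u v ⊎-dec arc? v u))
    ×-dec all? (λ u → all? λ v → arc? u v →-dec ¬? (arc? v u)))
    where
    arc? : ∀ u v → Dec (Arc D u v)
    arc? u v = v ∈? lookup D u

  hasATOrientation? : ∀ k → Dec (HasATOrientation k)
  hasATOrientation? k = dec-∃ ∈-allDigraphs λ D →
    (isOrientation? D ×-dec ¬? (EE D ≟ EO D)) ×-dec all? (λ v → outDegree D v <? k)

  -- Orienting every edge towards its larger end gives an acyclic
  -- orientation, whose only Eulerian subgraph is the empty one.

  up? : ∀ u v → Dec (u <ᶠ v × Adj G u v)
  up? u v = (u <ᶠ? v) ×-dec adj? G u v

  acyclic : Digraph n
  acyclic = tabulate λ u → tabulate λ v → does (up? u v)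

  arc-acyclic : ∀ u v → lookup (lookup acyclic u) v ≡ does (up? u v)
  arc-acyclic u v = trans
    (cong (λ S → lookup S v) (lookup∘tabulate (λ w → tabulate λ x → does (up? w x)) u))
    (lookup∘tabulate (λ x → does (up? u x)) v)

  acyclic⁻ : ∀ {u v} → Arc acyclic u v → u <ᶠ v × Adj G u v
  acyclic⁻ {u} {v} uv =
    does-true (up? u v) (trans (sym (arc-acyclic u v)) ([]=⇒lookup uv))
    where
    does-true : {A : Set} (A? : Dec A) → does A? ≡ true → A
    does-true (yes a) _ = a

  acyclic⁺ : ∀ {u v} → u <ᶠ v → Adj G u v → Arc acyclic u v
  acyclic⁺ {u} {v} u<v uv =
    lookup⇒[]= v _ (trans (arc-acyclic u v) (dec-true (up? u v) (u<v , uv)))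

  acyclic-isOrientation : IsOrientation acyclic
  acyclic-isOrientation = orientation
    (λ u v → proj₂ ∘ acyclic⁻)
    total
    (λ u v uv vu → ℕ.<-asym (proj₁ (acyclic⁻ uv)) (proj₁ (acyclic⁻ vu)))
    where
    total : ∀ u v → Adj G u v → Arc acyclic u v ⊎ Arc acyclic v u
    total u v uv with <-cmp u v
    ... | tri< u<v _ _ = inj₁ (acyclic⁺ u<v uv)
    ... | tri≈ _ u≡v _ = contradiction uv (irreflexive G u≡v)
    ... | tri> _ _ v<u = inj₂ (acyclic⁺ v<u (symmetric G uv))

  acyclic-eulerian : ∀ H → EulerianSubgraph acyclic H → ∀ v → outDegree H v ≡ 0
  acyclic-eulerian H (sub , bal) v = go v (<ᶠ-wellFounded v)
    where
    empty⇒0 : (S : Subset n) → ¬ Nonempty S → ∣ S ∣ ≡ 0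
    empty⇒0 S ne = trans (cong ∣_∣ (Empty-unique ne)) (∣⊥∣≡0 n)

    0⇒empty : ∀ (S : Subset n) x → ∣ S ∣ ≡ 0 → x ∉ S
    0⇒empty S x eq x∈S =
      ℕ.n≮0 (subst (∣ ⊥ {n} ∣ <_) eq (p⊂q⇒∣p∣<∣q∣ (⊥⊆ , x , x∈S , ∉⊥)))

    go : ∀ v → Acc _<ᶠ_ v → outDegree H v ≡ 0
    go v (acc rs) = trans (bal v) (empty⇒0 (inNeighbours H v) λ (u , u∈) →
      let uv : Arc H u v
          uv = lookup⇒[]= v _
                 (trans (sym (lookup-map u (λ out → lookup out v) H)) ([]=⇒lookup u∈))
          u<v = proj₁ (acyclic⁻ (sub u uv))
      in 0⇒empty (lookup H u) v (go u (rs u<v)) uv)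

  size-0 : ∀ {m} (H : Vec (Subset n) m) → (∀ v → ∣ lookup H v ∣ ≡ 0) →
           Vec.sum (Vec.map ∣_∣ H) ≡ 0
  size-0 []      _  = refl
  size-0 (S ∷ H) eq = cong₂ _+_ (eq zero) (size-0 H (eq ∘ suc))

  EO-acyclic : EO acyclic ≡ 0
  EO-acyclic = cong length (filter-none (oddEulerian? acyclic)
    (All.universal (λ H (eul , odd) →
      odd (subst (2 ∣_) (sym (size-0 H (acyclic-eulerian H eul))) (2 ∣0))) (allDigraphs n)))

  EE-acyclic : EE acyclic ≢ 0
  EE-acyclic = nonempty
    (∈-filter⁺ (evenEulerian? acyclic) (∈-allDigraphs ∅) ((∅⊆ , ∅-balanced) , ∅-even))
    where
    ∅ : Digraph n
    ∅ = replicate n ⊥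

    nonempty : ∀ {A : Set} {x : A} {xs} → x ∈ˡ xs → length xs ≢ 0
    nonempty (here _)  ()
    nonempty (there _) ()

    ∅-out : ∀ v → outDegree ∅ v ≡ 0
    ∅-out v = trans (cong ∣_∣ (lookup-replicate v (⊥ {n}))) (∣⊥∣≡0 n)

    ∅⊆ : SpanningSubgraph acyclic ∅
    ∅⊆ v x∈ = contradiction (subst (_ ∈_) (lookup-replicate v ⊥) x∈) ∉⊥

    column : ∀ m (v : Fin n) →
             ∣ Vec.map (λ out → lookup out v) (replicate m (⊥ {n})) ∣ ≡ 0
    column zero    v = refl
    column (suc m) v rewrite lookup-replicate v outside = column m v

    ∅-balanced : ∀ v → outDegree ∅ v ≡ inDegree ∅ v
    ∅-balanced v = trans (∅-out v) (sym (column n v))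

    ∅-even : 2 ∣ size ∅
    ∅-even = subst (2 ∣_) (sym (size-0 ∅ ∅-out)) (2 ∣0)

  hasATOrientation-1+n : HasATOrientation (suc n)
  hasATOrientation-1+n = acyclic
    , (acyclic-isOrientation , λ eq → EE-acyclic (trans eq EO-acyclic))
    , λ v → s≤s (∣p∣≤n (lookup acyclic v))

  AT-least : ∃ (IsLeast HasATOrientation)
  AT-least = least hasATOrientation? (suc n) hasATOrientation-1+n

  AT : ℕ
  AT = proj₁ AT-least

Tokens : ℕ → Set
Tokens n = Fin n → ℕ

_⊖_ : ∀ {n} → Tokens n → Subset n → Tokens n
(f ⊖ S) v = if lookup S v then pred (f v) else f v

module _ {n : ℕ} (G : Graph n) where

  record ListerMove (f : Tokens n) (S : Subset n) : Set where
    constructor listerMove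
    field
      nonempty : Nonempty S
      hasToken : ∀ v → v ∈ S → 0 < f v

  -- S is the set marked by Lister, C the vertices coloured before this turn,
  -- T the set Painter colours; colours need not be recorded, as each turn
  -- has its own.

  record PainterMove (C S T : Subset n) : Set where
    constructor painterMove
    field
      marked      : T ⊆ S
      uncoloured  : ∀ v → v ∈ T → v ∉ C
      independent : Independent G T

  -- Painter has a winning strategy from the position in which the
  -- remaining tokens are f and C is the set of vertices already coloured.
  -- The premise of turn that some token is left keeps it from applying
  -- vacuously to a finished game.

  data PainterWins (f : Tokens n) (C : Subset n) : Set where
    over : (∀ v → f v ≡ 0) → (∀ v → v ∈ C) → PainterWins f C
    turn : ¬ (∀ v → f v ≡ 0) →
           (∀ S → ListerMove f S →
              ∃ λ T → PainterMove C S T × PainterWins (f ⊖ S) (C ∪ T)) →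
           PainterWins f C

  Paintable : Tokens n → Set
  Paintable f = PainterWins f ⊥

  listerMove? : ∀ f S → Dec (ListerMove f S)
  listerMove? f S = map′ (λ (a , b) → listerMove a b) (λ (listerMove a b) → a , b)
    (nonempty? S ×-dec all? (λ v → (v ∈? S) →-dec (0 <? f v)))

  painterMove? : ∀ C S T → Dec (PainterMove C S T)
  painterMove? C S T =
    map′ (λ (a , b , c) → painterMove (λ {x} → a {x}) b c)
         (λ (painterMove a b c) → (λ {x} → a {x}) , b , c)
      ((T ⊆? S) ×-dec all? (λ v → (v ∈? T) →-dec ¬? (v ∈? C)) ×-dec independent? G T)

total : ∀ {n} → Tokens n → ℕ
total {zero}  f = 0
total {suc n} f = f zero + total (f ∘ suc)

⊖-≤ : ∀ {n} (f : Tokens n) S v → (f ⊖ S) v ≤ f v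
⊖-≤ f S v with lookup S v
... | true  = ℕ.pred[n]≤n
... | false = ℕ.≤-refl

⊖-< : ∀ {n} (f : Tokens n) S v → v ∈ S → 0 < f v → (f ⊖ S) v < f v
⊖-< f S v v∈S 0<fv rewrite []=⇒lookup v∈S with f v | 0<fv
... | suc m | _ = ℕ.≤-refl

total-≤ : ∀ {n} {f g : Tokens n} → (∀ v → f v ≤ g v) → total f ≤ total g
total-≤ {zero}  _   = z≤n
total-≤ {suc n} f≤g = ℕ.+-mono-≤ (f≤g zero) (total-≤ (f≤g ∘ suc))

total-< : ∀ {n} {f g : Tokens n} → (∀ v → f v ≤ g v) → ∀ v → f v < g v → total f < total g
total-< f≤g zero    lt = ℕ.+-mono-<-≤ lt (total-≤ (f≤g ∘ suc))
total-< f≤g (suc v) lt = ℕ.+-mono-≤-< (f≤g zero) (total-< (f≤g ∘ suc) v lt)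

module _ {n : ℕ} (G : Graph n) where

  total-⊖ : ∀ {f S} → ListerMove G f S → total (f ⊖ S) < total f
  total-⊖ {f} {S} (listerMove (v , v∈S) tok) =
    total-< (⊖-≤ f S) v (⊖-< f S v v∈S (tok v v∈S))

  painterWins? : ∀ m f C → total f < m → Dec (PainterWins G f C)
  painterWins? (suc m) f C (s≤s f≤m) with all? (λ v → f v ≟ 0)
  ... | yes f≡0 = map′ (over f≡0)
          (λ { (over _ all∈C) → all∈C ; (turn f≢0 _) → contradiction f≡0 f≢0 })
          (all? (_∈? C))
  ... | no f≢0 = map′ (turn f≢0)
          (λ { (over f≡0 _) → contradiction f≡0 f≢0 ; (turn _ s) → s })
          (dec-∀-Subset answer?)
    where
    answer? : ∀ S → Dec (ListerMove G f S →
                ∃ λ T → PainterMove G C S T × PainterWins G (f ⊖ S) (C ∪ T))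
    answer? S with listerMove? G f S
    ... | no ¬mv = yes (λ mv → contradiction mv ¬mv)
    ... | yes mv = map′ const (λ s → s mv)
      (anySubset? λ T → painterMove? G C S T ×-dec
         painterWins? m (f ⊖ S) (C ∪ T) (ℕ.<-≤-trans (total-⊖ mv) f≤m))

  paintable? : ∀ f → Dec (Paintable G f)
  paintable? f = painterWins? (suc (total f)) f ⊥ ℕ.≤-refl

  -- With n tokens everywhere Painter wins by colouring one uncoloured
  -- marked vertex per turn whenever there is one.

  one-by-one : ∀ m f C → total f < m → (∀ v → v ∉ C → n ≤ f v + ∣ C ∣) → PainterWins G f C
  one-by-one (suc m) f C (s≤s f≤m) inv with all? (λ v → f v ≟ 0)
  ... | yes f≡0 = over f≡0 λ v → decidable-stable (v ∈? C) λ v∉C →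
          v∉C (subst (v ∈_) (sym (∣p∣≡n⇒p≡⊤ (ℕ.≤-antisym (∣p∣≤n C)
            (subst (λ x → n ≤ x + ∣ C ∣) (f≡0 v) (inv v v∉C))))) ∈⊤)
  ... | no f≢0 = turn f≢0 answer
    where
    answer : ∀ S → ListerMove G f S →
             ∃ λ T → PainterMove G C S T × PainterWins G (f ⊖ S) (C ∪ T)
    answer S mv with any? (λ v → (v ∈? S) ×-dec ¬? (v ∈? C))
    ... | yes (x , x∈S , x∉C) = ⁅ x ⁆
        , painterMove (λ y∈ → subst (_∈ S) (sym (x∈⁅y⁆⇒x≡y x y∈)) x∈S)
                      (λ y y∈ → subst (_∉ C) (sym (x∈⁅y⁆⇒x≡y x y∈)) x∉C)
                      (λ u v u∈ v∈ → irreflexive G (trans (x∈⁅y⁆⇒x≡y x u∈) (sym (x∈⁅y⁆⇒x≡y x v∈))))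
        , one-by-one m (f ⊖ S) (C ∪ ⁅ x ⁆) (ℕ.<-≤-trans (total-⊖ mv) f≤m) inv′
      where
      grow : ∣ C ∣ < ∣ C ∪ ⁅ x ⁆ ∣
      grow = p⊂q⇒∣p∣<∣q∣ (p⊆p∪q ⁅ x ⁆ , x , q⊆p∪q C ⁅ x ⁆ (x∈⁅x⁆ x) , x∉C)

      ⊖-suc : ∀ v → f v ≤ suc ((f ⊖ S) v)
      ⊖-suc v with lookup S v | f v
      ... | true  | zero  = z≤n
      ... | true  | suc _ = ℕ.≤-refl
      ... | false | a     = ℕ.n≤1+n a

      inv′ : ∀ v → v ∉ C ∪ ⁅ x ⁆ → n ≤ (f ⊖ S) v + ∣ C ∪ ⁅ x ⁆ ∣
      inv′ v v∉ = ℕ.≤-trans (inv v (v∉ ∘ p⊆p∪q ⁅ x ⁆))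
        (ℕ.≤-trans (ℕ.+-monoˡ-≤ ∣ C ∣ (⊖-suc v))
        (ℕ.≤-trans (ℕ.≤-reflexive (sym (ℕ.+-suc ((f ⊖ S) v) ∣ C ∣)))
                   (ℕ.+-monoʳ-≤ ((f ⊖ S) v) grow)))
    ... | no none = ⊥
        , painterMove ⊥⊆ (λ v v∈ → contradiction v∈ ∉⊥) (λ u v u∈ → contradiction u∈ ∉⊥)
        , one-by-one m (f ⊖ S) (C ∪ ⊥) (ℕ.<-≤-trans (total-⊖ mv) f≤m) inv′
      where
      keep : ∀ v → v ∉ C → f v ≤ (f ⊖ S) v
      keep v v∉C with lookup S v in eq
      ... | true  = contradiction (v , lookup⇒[]= v S eq , v∉C) none
      ... | false = ℕ.≤-refl

      inv′ : ∀ v → v ∉ C ∪ ⊥ → n ≤ (f ⊖ S) v + ∣ C ∪ ⊥ ∣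
      inv′ v v∉ = ℕ.≤-trans (inv v v∉C)
        (ℕ.+-mono-≤ (keep v v∉C) (p⊆q⇒∣p∣≤∣q∣ (p⊆p∪q {p = C} ⊥)))
        where
        v∉C : v ∉ C
        v∉C = v∉ ∘ p⊆p∪q ⊥

  paintable-n : Paintable G (const n)
  paintable-n = one-by-one (suc (total {n} (const n))) (const n) ⊥ ℕ.≤-refl
    (λ _ _ → ℕ.m≤m+n n _)

  χP-least : ∃ (IsLeast (λ k → Paintable G (const k)))
  χP-least = least (λ k → paintable? (const k)) n paintable-n

  χP : ℕ
  χP = proj₁ χP-least

{-# OPTIONS --safe #-}
-- χP ≤ AT.  For the polynomial P = ∏ (x_u - x_v) over the arcs of D, the
-- coefficient of the monomial of out-degrees is EE D - EO D.  Suppose a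
-- monomial x^f with f below the remaining tokens occurs in P, and Lister
-- marks S.  As P is homogeneous, [α = f] may be replaced by [α = f off S] times
-- ∏ [α_v ≥ f_v] over S, and each [α_v ≥ f_v] = 1 - Σ_{b < f_v} [α_v = b] expanded.
-- In a term that does not vanish let T be the vertices of S where 1 was chosen.
-- Their exponents are unconstrained, so that x_u - x_v contributes 0 if u and v
-- both lie in T: thus T is independent, and Painter colours it.  The other
-- vertices of S have their exponents lowered, and deleting the edges at T
-- leaves a monomial with the required property.
--
-- AT ≤ s + 1, where s = ⌊4rd/(4r+1)⌋ + 1.  If the arcs never go up along some
-- ranking, and those within a rank join two sides, then all Eulerian subgraphs
-- are even.  So one may peel off layers S of the remaining graph W, directing
-- arcs from S to the rest: either a single vertex of degree at most s in W, or
-- a set S inducing a bipartite graph, given a balanced orientation, of minimum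
-- degree at least 2(d - s), since then each vertex has in-degree at least d - s.
-- If all degrees exceed s ≥ 4r(d - s), then averaging over pairs of colour
-- classes yields a dense bipartite subgraph, and pruning it such an S.
module Submission where

open import Defs

-- Finite sums of natural numbers and the Kronecker delta.

module FiniteSums where

  open import Data.Bool.Base using (Bool; true; false; if_then_else_)
  open import Data.Fin.Base using (Fin; zero; suc)
  open import Data.Fin.Properties using () renaming (_≟_ to _≟ᶠ_)
  open import Data.Nat.Base using (ℕ; zero; suc; _+_; _*_; _≤_; z≤n)
  import Data.Nat.Properties as ℕ
  open import Function.Base using (_∘_)
  open import Relation.Binary.PropositionalEquality
    using (_≡_; _≢_; refl; sym; trans; cong; cong₂)
  open import Relation.Nullary.Decidable using (yes; no; does)
  open import Relation.Nullary.Negation using (contradiction)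

  open import Algebra.Properties.Semiring.Sum ℕ.+-*-semiring public
    using (sum; sum-cong-≗; ∑-distrib-+; ∑-comm; *-distribˡ-sum; *-distribʳ-sum; sum-replicate-zero)

  bit : Bool → ℕ
  bit true  = 1
  bit false = 0

  δ : ∀ {n} → Fin n → Fin n → ℕ
  δ u v = if does (u ≟ᶠ v) then 1 else 0

  δ-refl : ∀ {n} (u : Fin n) → δ u u ≡ 1
  δ-refl u with u ≟ᶠ u
  ... | yes _  = refl
  ... | no u≢u = contradiction refl u≢u

  δ-≢ : ∀ {n} {u v : Fin n} → u ≢ v → δ u v ≡ 0
  δ-≢ {u = u} {v} u≢v with u ≟ᶠ v
  ... | yes u≡v = contradiction u≡v u≢v
  ... | no _    = refl

  δ-sym : ∀ {n} (u v : Fin n) → δ u v ≡ δ v u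
  δ-sym u v with u ≟ᶠ v
  ... | yes refl = sym (δ-refl u)
  ... | no u≢v   = sym (δ-≢ (u≢v ∘ sym))

  δ-suc : ∀ {n} (u v : Fin n) → δ (suc u) (suc v) ≡ δ u v
  δ-suc u v with u ≟ᶠ v
  ... | yes _ = refl
  ... | no _  = refl

  sum-δ : ∀ {n} (u : Fin n) (g : Fin n → ℕ) → sum (λ v → δ u v * g v) ≡ g u
  sum-δ {suc n} zero    g = trans (cong₂ _+_ (ℕ.*-identityˡ (g zero)) (sum-replicate-zero n)) (ℕ.+-identityʳ (g zero))
  sum-δ {suc n} (suc u) g = trans (sum-cong-≗ (λ v → cong (_* g (suc v)) (δ-suc u v))) (sum-δ u (g ∘ suc))

  sum-δ-const : ∀ {n} (u : Fin n) k → sum (λ v → k * δ u v) ≡ k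
  sum-δ-const u k = trans (sum-cong-≗ λ v → ℕ.*-comm k (δ u v)) (sum-δ u (λ _ → k))

  sum-mono : ∀ {n} {f g : Fin n → ℕ} → (∀ i → f i ≤ g i) → sum f ≤ sum g
  sum-mono {zero}  le = z≤n
  sum-mono {suc n} le = ℕ.+-mono-≤ (le zero) (sum-mono (le ∘ suc))

  -- This serves `layered-even`, where it is applied first to the sums over rows and then to the
  -- entries of one row.
  sum-tight : ∀ {n} {f g : Fin n → ℕ} → (∀ i → f i ≤ g i) → sum g ≤ sum f → ∀ i → f i ≡ g i
  sum-tight {suc n} {f} {g} le eq zero    = ℕ.≤-antisym (le zero)
    (ℕ.+-cancelʳ-≤ (sum (f ∘ suc)) (g zero) (f zero)
      (ℕ.≤-trans (ℕ.+-monoʳ-≤ (g zero) (sum-mono (le ∘ suc))) eq))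
  sum-tight {suc n} {f} {g} le eq (suc i) = sum-tight (le ∘ suc)
    (ℕ.+-cancelˡ-≤ (g zero) _ _ (ℕ.≤-trans eq (ℕ.+-monoˡ-≤ _ (le zero)))) i

  term≤sum : ∀ {n} (f : Fin n → ℕ) i → f i ≤ sum f
  term≤sum f zero    = ℕ.m≤m+n (f zero) _
  term≤sum f (suc i) = ℕ.≤-trans (term≤sum (f ∘ suc) i) (ℕ.m≤n+m _ (f zero))

-- The graph polynomial and Painter's strategy.

module GraphPolynomial where

  open import Data.Bool.Base using (Bool; true; false)
  open import Data.Fin.Base using (Fin; zero; suc)
  open import Data.Fin.Properties using (all?) renaming (_≟_ to _≟ᶠ_)
  open import Data.Fin.Subset using (Subset; ⊥; outside; _∈_; _∉_; _⊆_; _∪_; _∩_; ∁)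
  open import Data.Fin.Subset.Properties
    using (_∈?_; p⊆p∪q; q⊆p∪q; p∩q⊆p; p∩q⊆q; x∈p∩q⁺; x∈∁p⇒x∉p; x∉p⇒x∈∁p)
  open import Data.Integer.Base using (ℤ; 0ℤ; 1ℤ; _+_; _-_; _*_)
  open import Data.Integer.Properties as ℤ using (+-identityʳ; *-zeroˡ; *-distribʳ-+; +-inverseʳ)
  open import Data.Integer.Tactic.RingSolver using (solve-∀)
  open import Data.List.Base using (List; []; _∷_; _++_; length; filter)
  open import Data.List.Membership.Propositional using () renaming (_∈_ to _∈ˡ_)
  open import Data.List.Membership.Propositional.Properties using (∈-filter⁺)
  open import Data.List.Relation.Binary.Permutation.Propositional
    using (_↭_; refl; prep; swap; trans; ↭-sym)
  open import Data.List.Relation.Binary.Permutation.Propositional.Properties using (shift)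
  open import Data.List.Relation.Unary.All as All using (All; []; _∷_)
  open import Data.List.Relation.Unary.All.Properties using (all-filter)
  open import Data.List.Relation.Unary.Any using (here; there)
  open import Data.Nat.Base as ℕ using (ℕ; zero; suc; z≤n; s≤s)
  import Data.Nat.Properties as ℕ
  open import Data.Product.Base using (∃; _×_; _,_; proj₁; proj₂)
  open import Data.Sum.Base using (_⊎_; inj₁; inj₂)
  open import Data.Vec.Base as Vec using (Vec; []; _∷_; lookup; updateAt; head; tail)
  open import Data.Vec.Properties
    using (updateAt-commutes; lookup∘updateAt′; lookup-zipWith; lookup-map;
           lookup-replicate; []=⇒lookup; lookup⇒[]=)
  open import Data.Vec.Relation.Binary.Pointwise.Inductive as Pointwise
    using (Pointwise; []; _∷_)
  open import Function.Base using (_∘_)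
  open import Relation.Binary.Definitions using (tri<; tri≈; tri>)
  open import Relation.Binary.PropositionalEquality
    using (_≡_; _≢_; refl; sym; cong; cong₂; subst; module ≡-Reasoning) renaming (trans to
           ≡-trans)
  open import Relation.Nullary.Decidable using (Dec; yes; no; ¬?; _×-dec_; decidable-stable)
  open import Relation.Nullary.Negation using (¬_; contradiction)

  Edge : ℕ → Set
  Edge n = Fin n × Fin n

  bump : ∀ {n} → Vec ℕ n → Fin n → Vec ℕ n
  bump α u = updateAt α u suc

  bump-comm : ∀ {n} (α : Vec ℕ n) u v → bump (bump α u) v ≡ bump (bump α v) u
  bump-comm α u v with v ≟ᶠ u
  ... | yes refl = refl
  ... | no  v≢u  = updateAt-commutes v u v≢u α

  sum-bump : ∀ {n} (α : Vec ℕ n) u → Vec.sum (bump α u) ≡ suc (Vec.sum α)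
  sum-bump (a ∷ α) zero    = refl
  sum-bump (a ∷ α) (suc u) = ≡-trans (cong (a ℕ.+_) (sum-bump α u)) (ℕ.+-suc a _)

  -- The image of the polynomial x^α ∏ (x_u - x_v), over the edges (u , v) of
  -- the list, under the linear map sending each monomial x^β to w β.

  expand : ∀ {n} → List (Edge n) → Vec ℕ n → (Vec ℕ n → ℤ) → ℤ
  expand []            α w = w α
  expand ((u , v) ∷ E) α w = expand E (bump α u) w - expand E (bump α v) w

  -- A derivation is a choice of one end for each edge, so these are the monomials before
  -- cancellation. Only on them does a weight matter, see `expand-cong`.
  data Monomial {n} : List (Edge n) → Vec ℕ n → Vec ℕ n → Set where
    done  : ∀ {α} → Monomial [] α α
    left  : ∀ {u v E α β} → Monomial E (bump α u) β → Monomial ((u , v) ∷ E) α β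
    right : ∀ {u v E α β} → Monomial E (bump α v) β → Monomial ((u , v) ∷ E) α β

  -- Homogeneity: whichever end is chosen, an edge adds one to the total degree.
  monomial-sum : ∀ {n} {E : List (Edge n)} {α β} →
                 Monomial E α β → Vec.sum β ≡ Vec.sum α ℕ.+ length E
  monomial-sum {α = α} done = sym (ℕ.+-identityʳ (Vec.sum α))
  monomial-sum {E = _ ∷ E} {α} (left {u} p) = ≡-trans (monomial-sum p)
    (≡-trans (cong (ℕ._+ length E) (sum-bump α u)) (sym (ℕ.+-suc _ (length E))))
  monomial-sum {E = _ ∷ E} {α} (right {v = v} p) = ≡-trans (monomial-sum p)
    (≡-trans (cong (ℕ._+ length E) (sum-bump α v)) (sym (ℕ.+-suc _ (length E))))

  monomial-untouched : ∀ {n} {E : List (Edge n)} {α β t} →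
                       All (λ (u , v) → t ≢ u × t ≢ v) E →
                       Monomial E α β → lookup β t ≡ lookup α t
  monomial-untouched []                      done      = refl
  monomial-untouched {α = α} ((t≢u , _) ∷ o) (left p)  =
    ≡-trans (monomial-untouched o p) (lookup∘updateAt′ _ _ t≢u α)
  monomial-untouched {α = α} ((_ , t≢v) ∷ o) (right p) =
    ≡-trans (monomial-untouched o p) (lookup∘updateAt′ _ _ t≢v α)

  expand-cong : ∀ {n} (E : List (Edge n)) {α} {w w′ : Vec ℕ n → ℤ} →
                (∀ β → Monomial E α β → w β ≡ w′ β) → expand E α w ≡ expand E α w′
  expand-cong []      eq = eq _ done
  expand-cong (e ∷ E) eq = cong₂ _-_ (expand-cong E (λ β → eq β ∘ left))
                                     (expand-cong E (λ β → eq β ∘ right))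

  Additive : ∀ {n} → ((Vec ℕ n → ℤ) → ℤ) → Set
  Additive Φ = ∀ {w w₁ w₂} → (∀ α → w α ≡ w₁ α + w₂ α) → Φ w ≡ Φ w₁ + Φ w₂

  expand-additive : ∀ {n} (E : List (Edge n)) α → Additive (expand E α)
  expand-additive []            α eq = eq α
  expand-additive ((u , v) ∷ E) α {w₁ = w₁} {w₂} eq = ≡-trans
    (cong₂ _-_ (expand-additive E (bump α u) eq) (expand-additive E (bump α v) eq))
    (regroup (expand E (bump α u) w₁) (expand E (bump α u) w₂)
             (expand E (bump α v) w₁) (expand E (bump α v) w₂))
    where
    regroup : ∀ a b c d → (a + b) - (c + d) ≡ (a - c) + (b - d)
    regroup = solve-∀

  -- The factors commute. For `swap`, a product of two binomials is multiplied out and its two mixed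
  -- terms change places.
  expand-↭ : ∀ {n} {E E′ : List (Edge n)} → E ↭ E′ → ∀ α w → expand E α w ≡ expand E′ α w
  expand-↭ refl                        α w = refl
  expand-↭ (prep (u , v) p)            α w =
    cong₂ _-_ (expand-↭ p (bump α u) w) (expand-↭ p (bump α v) w)
  expand-↭ (swap {xs = E} {ys = E′} (u , v) (x , y) p) α w = begin
    (⟦ E ⟧ u x - ⟦ E ⟧ u y) - (⟦ E ⟧ v x - ⟦ E ⟧ v y)
      ≡⟨ cong₂ _-_ (cong₂ _-_ (step u x) (step u y)) (cong₂ _-_ (step v x) (step v y)) ⟩
    (⟦ E′ ⟧ x u - ⟦ E′ ⟧ y u) - (⟦ E′ ⟧ x v - ⟦ E′ ⟧ y v)
      ≡⟨ exchange (⟦ E′ ⟧ x u) (⟦ E′ ⟧ y u) (⟦ E′ ⟧ x v) (⟦ E′ ⟧ y v) ⟩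
    (⟦ E′ ⟧ x u - ⟦ E′ ⟧ x v) - (⟦ E′ ⟧ y u - ⟦ E′ ⟧ y v) ∎
    where
    open ≡-Reasoning
    ⟦_⟧ : List _ → _ → _ → ℤ
    ⟦ F ⟧ a b = expand F (bump (bump α a) b) w

    step : ∀ a b → ⟦ E ⟧ a b ≡ ⟦ E′ ⟧ b a
    step a b = ≡-trans (expand-↭ p _ w) (cong (λ β → expand E′ β w) (bump-comm α a b))

    exchange : ∀ a b c d → (a - b) - (c - d) ≡ (a - c) - (b - d)
    exchange = solve-∀
  expand-↭ (trans p q)                 α w = ≡-trans (expand-↭ p α w) (expand-↭ q α w)

  difference-≢0 : ∀ a b → a - b ≢ 0ℤ → a ≢ 0ℤ ⊎ b ≢ 0ℤ
  difference-≢0 a b ne with a ℤ.≟ 0ℤ | b ℤ.≟ 0ℤ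
  ... | no a≢0   | _        = inj₁ a≢0
  ... | yes _    | no b≢0   = inj₂ b≢0
  ... | yes refl | yes refl = contradiction refl ne

  -- Functionals that ignore the exponents of a set of vertices.

  module _ {n : ℕ} (T : Fin n → Set) where

    -- The linear functional given by such a weight factors through the substitution of 1 for all
    -- variables x_t with t in T.
    Blind : (Vec ℕ n → ℤ) → Set
    Blind w = ∀ t → T t → ∀ α → w (bump α t) ≡ w α

    expand-blind : ∀ {w} → Blind w → ∀ E t → T t → ∀ α → expand E (bump α t) w ≡ expand E α w
    expand-blind blind []            t t∈ α = blind t t∈ α
    expand-blind {w} blind ((u , v) ∷ E) t t∈ α = cong₂ _-_ (step u) (step v)
      where
      step : ∀ x → expand E (bump (bump α t) x) w ≡ expand E (bump α x) w
      step x = ≡-trans (cong (λ β → expand E β w) (bump-comm α t x))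
                       (expand-blind blind E t t∈ (bump α x))

    -- Under that substitution the factor x_u - x_v becomes 1 - 1.
    expand-edge-inside : ∀ {w} → Blind w → ∀ {E u v} → T u → T v → (u , v) ∈ˡ E →
                         ∀ α → expand E α w ≡ 0ℤ
    expand-edge-inside {w} blind {_ ∷ E} {u} {v} u∈ v∈ (here refl) α = ≡-trans
      (cong₂ _-_ (expand-blind blind E u u∈ α) (expand-blind blind E v v∈ α))
      (+-inverseʳ (expand E α w))
    expand-edge-inside blind u∈ v∈ (there e∈) α =
      cong₂ _-_ (expand-edge-inside blind u∈ v∈ e∈ _) (expand-edge-inside blind u∈ v∈ e∈ _)

    -- A nonzero difference has a nonzero term. Each factor of `X` may therefore be replaced by one
    -- of its two variables, which is absorbed in the start exponent.
    expand-strip : ∀ {w} → Blind w → ∀ X {E} → All (λ (u , v) → T u ⊎ T v) X →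
                   ∀ α → expand (X ++ E) α w ≢ 0ℤ → ∃ λ α′ → expand E α′ w ≢ 0ℤ
    expand-strip blind []            []            α ne = α , ne
    expand-strip blind ((u , v) ∷ X) (_ ∷ touches) α ne
      with difference-≢0 (expand (X ++ _) (bump α u) _) (expand (X ++ _) (bump α v) _) ne
    ... | inj₁ ne′ = expand-strip blind X touches (bump α u) ne′
    ... | inj₂ ne′ = expand-strip blind X touches (bump α v) ne′

  -- Conditions on exponents and their expansion.

  -- An exponent that is atLeast 0 is unconstrained.

  data Condition : Set where
    exactly atLeast : ℕ → Condition

  ⟦_⟧ : Condition → ℕ → ℤ
  ⟦ exactly zero    ⟧ zero    = 1ℤ
  ⟦ exactly zero    ⟧ (suc a) = 0ℤ
  ⟦ exactly (suc m) ⟧ zero    = 0ℤ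
  ⟦ exactly (suc m) ⟧ (suc a) = ⟦ exactly m ⟧ a
  ⟦ atLeast zero    ⟧ a       = 1ℤ
  ⟦ atLeast (suc m) ⟧ zero    = 0ℤ
  ⟦ atLeast (suc m) ⟧ (suc a) = ⟦ atLeast m ⟧ a

  -- Written with `head` and `tail` so that it unfolds at a variable `α`, as the appeals to
  -- additivity below require.
  indicator : ∀ {n} → Vec Condition n → Vec ℕ n → ℤ
  indicator []      α = 1ℤ
  indicator (c ∷ k) α = ⟦ c ⟧ (head α) * indicator k (tail α)

  ⟦atLeast⟧-step : ∀ m a → ⟦ atLeast m ⟧ a ≡ ⟦ atLeast (suc m) ⟧ a + ⟦ exactly m ⟧ a
  ⟦atLeast⟧-step zero    zero    = refl
  ⟦atLeast⟧-step zero    (suc a) = refl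
  ⟦atLeast⟧-step (suc m) zero    = refl
  ⟦atLeast⟧-step (suc m) (suc a) = ⟦atLeast⟧-step m a

  -- In the expansion of [a ≥ m], `free` stands for the term 1 and `below` for one of the terms
  -- [a = b].
  data _⇝_ : Condition → Condition → Set where
    same  : ∀ {m} → exactly m ⇝ exactly m
    free  : ∀ {m} → atLeast m ⇝ atLeast 0
    below : ∀ {m b} → b ℕ.< m → atLeast m ⇝ exactly b

  sum-≢0 : ∀ a b c → a ≡ b + c → b ≢ 0ℤ → a ≢ 0ℤ ⊎ c ≢ 0ℤ
  sum-≢0 a b c eq b≢0 with a ℤ.≟ 0ℤ | c ℤ.≟ 0ℤ
  ... | no a≢0   | _        = inj₁ a≢0
  ... | yes _    | no c≢0   = inj₂ c≢0
  ... | yes refl | yes refl = contradiction (≡-trans (sym (+-identityʳ b)) (sym eq)) b≢0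

  -- [a ≥ m] = 1 - Σ_{b < m} [a = b], so if the left side contributes then so
  -- does one of the terms on the right.

  refine-atLeast : ∀ {n} {Φ : (Vec ℕ (suc n) → ℤ) → ℤ} → Additive Φ → ∀ m k →
                   Φ (indicator (atLeast m ∷ k)) ≢ 0ℤ →
                   ∃ λ c → atLeast m ⇝ c × Φ (indicator (c ∷ k)) ≢ 0ℤ
  refine-atLeast         add zero    k ne = atLeast 0 , free , ne
  refine-atLeast {Φ = Φ} add (suc m) k ne
    with sum-≢0 (Φ (indicator (atLeast m ∷ k))) _ (Φ (indicator (exactly m ∷ k)))
           (add λ α → ≡-trans (cong (_* indicator k (tail α)) (⟦atLeast⟧-step m (head α)))
                              (*-distribʳ-+ (indicator k (tail α)) (⟦ atLeast (suc m) ⟧ (head α)) _))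
           ne
  ... | inj₂ ne′ = exactly m , below ℕ.≤-refl , ne′
  ... | inj₁ ne′ with refine-atLeast {Φ = Φ} add m k ne′
  ...   | c , free      , ne″ = c , free , ne″
  ...   | c , below b<m , ne″ = c , below (ℕ.m<n⇒m<1+n b<m) , ne″

  refine-head : ∀ {n} {Φ : (Vec ℕ (suc n) → ℤ) → ℤ} → Additive Φ → ∀ c k →
                Φ (indicator (c ∷ k)) ≢ 0ℤ → ∃ λ c′ → c ⇝ c′ × Φ (indicator (c′ ∷ k)) ≢ 0ℤ
  refine-head         add (exactly m) k ne = exactly m , same , ne
  refine-head {Φ = Φ} add (atLeast m) k ne = refine-atLeast {Φ = Φ} add m k ne

  -- One coordinate is refined at a time: once the condition at the head is settled, multiplying by
  -- its indicator and then applying `Φ` is again an additive functional, now of the tail.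
  refine : ∀ {n} {Φ : (Vec ℕ n → ℤ) → ℤ} → Additive Φ → ∀ k →
           Φ (indicator k) ≢ 0ℤ → ∃ λ k′ → Pointwise _⇝_ k k′ × Φ (indicator k′) ≢ 0ℤ
  refine         add []      ne = [] , [] , ne
  refine {Φ = Φ} add (c ∷ k) ne with refine-head {Φ = Φ} add c k ne
  ... | c′ , c⇝c′ , ne′
    with refine {Φ = λ w → Φ (λ α → ⟦ c′ ⟧ (head α) * w (tail α))}
           (λ eq → add λ α → ≡-trans (cong (⟦ c′ ⟧ (head α) *_) (eq (tail α)))
                                     (ℤ.*-distribˡ-+ (⟦ c′ ⟧ (head α)) _ _))
           k ne′
  ...   | k′ , k⇝k′ , ne″ = c′ ∷ k′ , c⇝c′ ∷ k⇝k′ , ne″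

  indicator-cong : ∀ {n} (k k′ : Vec Condition n) α →
                   (∀ v → ⟦ lookup k v ⟧ (lookup α v) ≡ ⟦ lookup k′ v ⟧ (lookup α v)) →
                   indicator k α ≡ indicator k′ α
  indicator-cong []      []        []      eq = refl
  indicator-cong (c ∷ k) (c′ ∷ k′) (a ∷ α) eq =
    cong₂ _*_ (eq zero) (indicator-cong k k′ α (eq ∘ suc))

  indicator-blind : ∀ {n} (k : Vec Condition n) → Blind (λ t → lookup k t ≡ atLeast 0) (indicator k)
  indicator-blind k t eq α = go k t eq α
    where
    go : ∀ {n} (k : Vec Condition n) t → lookup k t ≡ atLeast 0 →
         ∀ α → indicator k (bump α t) ≡ indicator k α
    go (c ∷ k) zero    refl (a ∷ α) = refl
    go (c ∷ k) (suc t) eq   (a ∷ α) = cong (⟦ c ⟧ a *_) (go k t eq α)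

  condition : Bool → ℕ → Condition
  condition false m = exactly m
  condition true  m = atLeast m

  -- For `conditions ⊥ f` the indicator extracts the coefficient of the monomial x^f.
  conditions : ∀ {n} → Vec Bool n → Vec ℕ n → Vec Condition n
  conditions = Vec.zipWith condition

  ⟦condition⟧-refl : ∀ s m → ⟦ condition s m ⟧ m ≡ 1ℤ
  ⟦condition⟧-refl false zero    = refl
  ⟦condition⟧-refl true  zero    = refl
  ⟦condition⟧-refl false (suc m) = ⟦condition⟧-refl false m
  ⟦condition⟧-refl true  (suc m) = ⟦condition⟧-refl true m

  ⟦condition⟧-< : ∀ s {m a} → a ℕ.< m → ⟦ condition s m ⟧ a ≡ 0ℤ
  ⟦condition⟧-< false (s≤s z≤n)       = refl
  ⟦condition⟧-< true  (s≤s z≤n)       = refl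
  ⟦condition⟧-< false (s≤s (s≤s a<m)) = ⟦condition⟧-< false (s≤s a<m)
  ⟦condition⟧-< true  (s≤s (s≤s a<m)) = ⟦condition⟧-< true (s≤s a<m)

  indicator-refl : ∀ {n} (S : Vec Bool n) f → indicator (conditions S f) f ≡ 1ℤ
  indicator-refl []      []      = refl
  indicator-refl (s ∷ S) (m ∷ f) = cong₂ _*_ (⟦condition⟧-refl s m) (indicator-refl S f)

  indicator-≱ : ∀ {n} (S : Vec Bool n) f α → (∃ λ v → lookup α v ℕ.< lookup f v) →
                indicator (conditions S f) α ≡ 0ℤ
  indicator-≱ (s ∷ S) (m ∷ f) (a ∷ α) (zero  , a<m) =
    ≡-trans (cong (_* indicator (conditions S f) α) (⟦condition⟧-< s a<m)) (*-zeroˡ (indicator (conditions S f) α))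
  indicator-≱ (s ∷ S) (m ∷ f) (a ∷ α) (suc v , lt)  =
    ≡-trans (cong (⟦ condition s m ⟧ a *_) (indicator-≱ S f α (v , lt))) (ℤ.*-zeroʳ (⟦ condition s m ⟧ a))

  -- If no coordinate of `α` is below that of `f`, the bound on the sums leaves no room for one
  -- above it.
  equal-or-below : ∀ {n} (f α : Vec ℕ n) → Vec.sum α ℕ.≤ Vec.sum f →
                   α ≡ f ⊎ ∃ λ v → lookup α v ℕ.< lookup f v
  equal-or-below []      []      _  = inj₁ refl
  equal-or-below (m ∷ f) (a ∷ α) le with a ℕ.<? m
  ... | yes a<m = inj₂ (zero , a<m)
  ... | no  a≮m with equal-or-below f α (ℕ.+-cancelˡ-≤ m _ _
                       (ℕ.≤-trans (ℕ.+-monoˡ-≤ (Vec.sum α) (ℕ.≮⇒≥ a≮m)) le))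
  ...   | inj₂ (v , lt) = inj₂ (suc v , lt)
  ...   | inj₁ refl     = inj₁ (cong (_∷ f) (ℕ.≤-antisym (ℕ.+-cancelʳ-≤ (Vec.sum f) a m le) (ℕ.≮⇒≥ a≮m)))

  -- Up to the total degree of `f`, either indicator singles out `f` itself: any other exponent is
  -- below `f` somewhere, which violates an exact condition as well as a lower bound.
  indicator-irrelevant : ∀ {n} (S S′ : Vec Bool n) f α → Vec.sum α ℕ.≤ Vec.sum f →
                         indicator (conditions S f) α ≡ indicator (conditions S′ f) α
  indicator-irrelevant S S′ f α le with equal-or-below f α le
  ... | inj₁ refl = ≡-trans (indicator-refl S f) (sym (indicator-refl S′ f))
  ... | inj₂ lt   = ≡-trans (indicator-≱ S f α lt) (sym (indicator-≱ S′ f α lt))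

  indicator-≢ : ∀ {n} (f α : Vec ℕ n) → α ≢ f → indicator (conditions ⊥ f) α ≡ 0ℤ
  indicator-≢ []      []      α≢f = contradiction refl α≢f
  indicator-≢ (m ∷ f) (a ∷ α) α≢f with ℕ.<-cmp a m
  ... | tri< a<m _ _  = indicator-≱ ⊥ (m ∷ f) (a ∷ α) (zero , a<m)
  ... | tri≈ _ refl _ = ≡-trans (cong (⟦ exactly m ⟧ m *_) (indicator-≢ f α (α≢f ∘ cong (m ∷_))))
                                (ℤ.*-zeroʳ (⟦ exactly m ⟧ m))
  ... | tri> _ _ m<a  = ≡-trans (cong (_* indicator (conditions ⊥ f) α) (⟦exactly⟧-> m<a))
                                (*-zeroˡ (indicator (conditions ⊥ f) α))
    where
    ⟦exactly⟧-> : ∀ {m a} → m ℕ.< a → ⟦ exactly m ⟧ a ≡ 0ℤ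
    ⟦exactly⟧-> {zero}  (s≤s _)  = refl
    ⟦exactly⟧-> {suc m} (s≤s lt) = ⟦exactly⟧-> lt

  expand-zero : ∀ {n} (E : List (Edge n)) α → expand E α (λ _ → 0ℤ) ≡ 0ℤ
  expand-zero []            α = refl
  expand-zero ((u , v) ∷ E) α = cong₂ _-_ (expand-zero E (bump α u)) (expand-zero E (bump α v))

  -- The monomial x^f occurs in x^α ∏ (x_u - x_v) with nonzero coefficient.
  NonVanishing : ∀ {n} → List (Edge n) → Vec ℕ n → Vec ℕ n → Set
  NonVanishing E α f = expand E α (indicator (conditions ⊥ f)) ≢ 0ℤ

  -- All monomials have the same total degree. Were it larger than that of `f`, then x^f could not
  -- occur.
  nonVanishing-sum : ∀ {n} (E : List (Edge n)) α f → NonVanishing E α f →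
                     ∀ β → Monomial E α β → Vec.sum β ℕ.≤ Vec.sum f
  nonVanishing-sum E α f ne β p = ℕ.≮⇒≥ λ lt → ne (≡-trans
    (expand-cong E λ γ q → indicator-≢ f γ λ { refl → ℕ.<-irrefl
       (≡-trans (monomial-sum q) (sym (monomial-sum p))) lt })
    (expand-zero E α))

  isFree : Condition → Bool
  isFree (exactly _) = false
  isFree (atLeast _) = true

  -- A free vertex keeps its start exponent `a`, since no edge at it will remain.
  settle : Condition → ℕ → ℕ
  settle (exactly m) a = m
  settle (atLeast _) a = a

  -- One turn: Painter's answer and the polynomial that remains.

  module Round {n : ℕ} (E : List (Edge n)) (α f : Vec ℕ n) (S : Subset n)
               (ne : NonVanishing E α f) where

    refined : ∃ λ k → Pointwise _⇝_ (conditions S f) k × expand E α (indicator k) ≢ 0ℤ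
    refined = refine {Φ = expand E α} (expand-additive E α) (conditions S f)
      -- By homogeneity the exact conditions on S may be weakened to lower bounds before they are
      -- expanded.
      λ eq → ne (≡-trans (expand-cong E λ β p →
        indicator-irrelevant ⊥ S f β (nonVanishing-sum E α f ne β p)) eq)

    k : Vec Condition n
    k = proj₁ refined

    T : Subset n
    T = Vec.map isFree k

    refinement : ∀ v → condition (lookup S v) (lookup f v) ⇝ lookup k v
    refinement v = subst (_⇝ lookup k v) (lookup-zipWith condition v S f)
      (Pointwise.lookup (proj₁ (proj₂ refined)) v)

    ∈T : ∀ {v} → v ∈ T → lookup S v ≡ true × lookup k v ≡ atLeast 0
    ∈T {v} v∈T with lookup S v | refinement v | ≡-trans (sym (lookup-map v isFree k)) ([]=⇒lookup v∈T)
    ... | true  | r | eq with lookup k v | r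
    ...   | _ | free = refl , refl
    ∈T {v} v∈T | false | r | eq with lookup k v | r
    ∈T {v} v∈T | false | r | () | _ | same

    ∉T : ∀ {v} → v ∉ T → ∃ λ b → lookup k v ≡ exactly b
    ∉T {v} v∉T with lookup k v in eq
    ... | exactly b = b , refl
    ... | atLeast m = contradiction
      (lookup⇒[]= v T (≡-trans (lookup-map v isFree k) (cong isFree eq))) v∉T

    blind : Blind (_∈ T) (indicator k)
    blind t t∈T = indicator-blind k t (proj₂ (∈T t∈T))

    T⊆S : T ⊆ S
    T⊆S t∈T = lookup⇒[]= _ S (proj₁ (∈T t∈T))

    noEdge : ∀ {u v} → u ∈ T → v ∈ T → ¬ (u , v) ∈ˡ E
    noEdge u∈T v∈T uv = proj₂ (proj₂ refined) (expand-edge-inside (_∈ T) blind u∈T v∈T uv α)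

    avoids? : ∀ (e : Edge n) → Dec (proj₁ e ∉ T × proj₂ e ∉ T)
    avoids? (u , v) = ¬? (u ∈? T) ×-dec ¬? (v ∈? T)

    E′ : List (Edge n)
    E′ = filter avoids? E

    -- The edges at T are moved to the front, where `expand-strip` can consume them.
    filter-split : ∀ (F : List (Edge n)) → ∃ λ X →
                   All (λ (u , v) → u ∈ T ⊎ v ∈ T) X × F ↭ X ++ filter avoids? F
    filter-split []            = [] , [] , refl
    filter-split ((u , v) ∷ F) with filter-split F | u ∈? T | v ∈? T
    ... | X , touch , p | yes u∈T | _       = (u , v) ∷ X , inj₁ u∈T ∷ touch , prep _ p
    ... | X , touch , p | no  _   | yes v∈T = (u , v) ∷ X , inj₂ v∈T ∷ touch , prep _ p
    ... | X , touch , p | no  _   | no  _   = X , touch , trans (prep _ p) (↭-sym (shift _ X _))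

    stripped : ∃ λ α′ → expand E′ α′ (indicator k) ≢ 0ℤ
    stripped with filter-split E
    ... | X , touch , p = expand-strip (_∈ T) blind X touch α
      λ eq → proj₂ (proj₂ refined) (≡-trans (expand-↭ p α (indicator k)) eq)

    α′ : Vec ℕ n
    α′ = proj₁ stripped

    f′ : Vec ℕ n
    f′ = Vec.zipWith settle k α′

    untouched : ∀ {t} → t ∈ T → All (λ (u , v) → t ≢ u × t ≢ v) E′
    untouched t∈T = All.map
      (λ (u∉ , v∉) → (λ eq → u∉ (subst (_∈ T) eq t∈T)) , (λ eq → v∉ (subst (_∈ T) eq t∈T)))
      (all-filter avoids? E)

    -- No edge of `E′` meets T, so every monomial has the exponents of `α′` there. Requiring exactly
    -- these turns the free conditions into exact ones without changing any value.
    nonVanishing′ : NonVanishing E′ α′ f′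
    nonVanishing′ eq = proj₂ stripped (≡-trans
      (expand-cong E′ λ β p → indicator-cong k (conditions ⊥ f′) β λ v → agree β p v) eq)
      where
      agree : ∀ β → Monomial E′ α′ β → ∀ v →
              ⟦ lookup k v ⟧ (lookup β v) ≡ ⟦ lookup (conditions ⊥ f′) v ⟧ (lookup β v)
      agree β p v rewrite lookup-zipWith condition v ⊥ f′ | lookup-replicate v outside
                        | lookup-zipWith settle v k α′ with v ∈? T
      ... | yes v∈T rewrite proj₂ (∈T v∈T) | monomial-untouched (untouched v∈T) p =
        sym (⟦condition⟧-refl false (lookup α′ v))
      ... | no  v∉T with lookup k v | ∉T v∉T
      ...   | _ | b , refl = refl

    edges-kept : ∀ {u v} → (u , v) ∈ˡ E → u ∉ T → v ∉ T → (u , v) ∈ˡ E′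
    edges-kept uv u∉ v∉ = ∈-filter⁺ avoids? uv (u∉ , v∉)

    f′-≤ : ∀ {v} → v ∉ T → lookup f′ v ℕ.≤ lookup f v
    f′-≤ {v} v∉T rewrite lookup-zipWith settle v k α′
      with lookup S v | lookup k v | refinement v | ∉T v∉T
    ... | false | _ | same      | _ = ℕ.≤-refl
    ... | true  | _ | below b<m | _ = ℕ.<⇒≤ b<m
    ... | true  | _ | free      | _ , ()

    f′-< : ∀ {v} → v ∉ T → v ∈ S → lookup f′ v ℕ.< lookup f v
    f′-< {v} v∉T v∈S rewrite lookup-zipWith settle v k α′
      with lookup S v | []=⇒lookup v∈S | lookup k v | refinement v | ∉T v∉T
    ... | true | refl | _ | below b<m | _ = b<m
    ... | true | refl | _ | free      | _ , ()

  -- The invariant of Painter's play. An edge may be listed in either direction, since reversing it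
  -- only changes the sign of the polynomial.
  record Surplus {n} (G : Graph n) (tok : Tokens n) (C : Subset n) : Set where
    field
      edges        : List (Edge n)
      start target : Vec ℕ n
      nonVanishing : NonVanishing edges start target
      complete     : ∀ u v → u ∉ C → v ∉ C → Adj G u v → (u , v) ∈ˡ edges ⊎ (v , u) ∈ˡ edges
      target-<     : ∀ v → v ∉ C → lookup target v ℕ.< tok v

  surplus-wins : ∀ {n} (G : Graph n) m tok C → total tok ℕ.< m → Surplus G tok C → PainterWins G tok C
  surplus-wins {n} G (suc m) tok C (s≤s tok≤m) sp with all? (λ v → tok v ℕ.≟ 0)
  -- An uncoloured vertex would have a target below 0.
  ... | yes tok≡0 = over tok≡0 λ v → decidable-stable (v ∈? C) λ v∉C →
          ℕ.n≮0 (subst (_ ℕ.<_) (tok≡0 v) (Surplus.target-< sp v v∉C))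
  ... | no tok≢0 = turn tok≢0 answer
    where
    open Surplus sp
    answer : ∀ S → ListerMove G tok S →
             ∃ λ T → PainterMove G C S T × PainterWins G (tok ⊖ S) (C ∪ T)
    answer S mv = T
      , painterMove (λ t∈T → p∩q⊆p S (∁ C) (T⊆S t∈T))
                    (λ v v∈T → x∈∁p⇒x∉p (p∩q⊆q S (∁ C) (T⊆S v∈T)))
                    independent
      , surplus-wins G m (tok ⊖ S) (C ∪ T) (ℕ.<-≤-trans (total-⊖ G mv) tok≤m) record
          { edges        = E′
          ; start        = α′
          ; target       = f′
          ; nonVanishing = nonVanishing′
          ; complete     = complete′
          ; target-<     = target-<′
          }
      where
      -- Lister may also mark coloured vertices; they are dropped, so that T avoids C.
      open Round edges start target (S ∩ ∁ C) nonVanishing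

      independent : Independent G T
      independent u v u∈T v∈T uv with complete u v
        (x∈∁p⇒x∉p (p∩q⊆q S (∁ C) (T⊆S u∈T))) (x∈∁p⇒x∉p (p∩q⊆q S (∁ C) (T⊆S v∈T))) uv
      ... | inj₁ e = noEdge u∈T v∈T e
      ... | inj₂ e = noEdge v∈T u∈T e

      ∉C : ∀ {v} → v ∉ C ∪ T → v ∉ C
      ∉C v∉ v∈C = v∉ (p⊆p∪q T v∈C)

      ∉T′ : ∀ {v} → v ∉ C ∪ T → v ∉ T
      ∉T′ v∉ v∈T = v∉ (q⊆p∪q C T v∈T)

      complete′ : ∀ u v → u ∉ C ∪ T → v ∉ C ∪ T → Adj G u v → (u , v) ∈ˡ E′ ⊎ (v , u) ∈ˡ E′
      complete′ u v u∉ v∉ uv with complete u v (∉C u∉) (∉C v∉) uv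
      ... | inj₁ e = inj₁ (edges-kept e (∉T′ u∉) (∉T′ v∉))
      ... | inj₂ e = inj₂ (edges-kept e (∉T′ v∉) (∉T′ u∉))

      target-<′ : ∀ v → v ∉ C ∪ T → lookup f′ v ℕ.< (tok ⊖ S) v
      target-<′ v v∉ with lookup S v in eq
      ... | false = ℕ.≤-<-trans (f′-≤ (∉T′ v∉)) (target-< v (∉C v∉))
      -- A marked vertex left uncoloured loses a token. Its new target is strictly below the old
      -- one, which is at most the number of tokens left.
      ... | true  = ℕ.<-≤-trans
        (f′-< (∉T′ v∉) (x∈p∩q⁺ (lookup⇒[]= v S eq , x∉p⇒x∈∁p (∉C v∉))))
        (ℕ.<⇒≤pred (target-< v (∉C v∉)))

-- Eulerian subgraphs as terms of the graph polynomial.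

module EulerianExpansion where

  open FiniteSums
  open GraphPolynomial
  open import Data.Bool.Base using (true; false)
  open import Data.Fin.Base using (Fin; zero; suc)
  open import Data.Fin.Properties using (suc-injective) renaming (_≟_ to _≟ᶠ_)
  open import Data.Fin.Subset using (Subset; ⊥; inside; outside; _∈_; _⊆_; ∣_∣)
  open import Data.Fin.Subset.Properties using (drop-∷-⊆; in⊆in; out⊆)
  open import Data.Integer.Base as ℤ using (ℤ; 0ℤ; 1ℤ; -1ℤ; -_)
  import Data.Integer.Properties as ℤ
  import Data.Integer.Tactic.RingSolver as ℤSolver
  open import Data.List.Base
    using (List; []; _∷_; _++_; length; filter; map; cartesianProductWith)
  open import Data.List.Membership.Propositional using () renaming (_∈_ to _∈ˡ_)
  open import Data.List.Membership.Propositional.Properties using (∈-++⁺ˡ; ∈-++⁺ʳ)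
  open import Data.List.Relation.Unary.Any using (here; there)
  open import Data.Nat.Base using (ℕ; zero; suc; s≤s; _+_; _*_; _<_; _≤_)
  open import Data.Nat.Divisibility using (_∣_; ∣m∣n⇒∣m+n; ∣m+n∣m⇒∣n; ∣-refl; ∣⇒≤; _∣0)
  import Data.Nat.Properties as ℕ
  open import Data.Nat.Tactic.RingSolver using (solve-∀)
  open import Data.Product.Base using (_,_; proj₁; proj₂)
  open import Data.Sum.Base as Sum using (_⊎_; inj₁; inj₂)
  open import Data.Vec.Base as Vec using (Vec; []; _∷_; lookup; replicate)
  open import Data.Vec.Properties
    using (lookup-map; lookup∘updateAt; lookup∘updateAt′; lookup-replicate)
  open import Data.Vec.Relation.Binary.Pointwise.Extensional using (ext; Pointwise-≡⇒≡)
  open import Function.Base using (_∘_; id; case_of_)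
  open import Function.Definitions using (Injective)
  open import Relation.Binary.PropositionalEquality
    using (_≡_; _≢_; refl; sym; trans; cong; cong₂; subst; module ≡-Reasoning)
  open import Relation.Nullary.Decidable using (Dec; yes; no)
  open import Relation.Nullary.Negation using (¬_; contradiction)

  sumOver : {A : Set} → List A → (A → ℤ) → ℤ
  sumOver []       F = 0ℤ
  sumOver (x ∷ xs) F = F x ℤ.+ sumOver xs F

  module _ {A : Set} where

    sumOver-cong : ∀ (xs : List A) {F G} → (∀ x → F x ≡ G x) → sumOver xs F ≡ sumOver xs G
    sumOver-cong []       eq = refl
    sumOver-cong (x ∷ xs) eq = cong₂ ℤ._+_ (eq x) (sumOver-cong xs eq)

    sumOver-*ˡ : ∀ c (xs : List A) F → c ℤ.* sumOver xs F ≡ sumOver xs (λ x → c ℤ.* F x)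
    sumOver-*ˡ c []       F = ℤ.*-zeroʳ c
    sumOver-*ˡ c (x ∷ xs) F = trans (ℤ.*-distribˡ-+ c (F x) (sumOver xs F))
                                    (cong (λ s → c ℤ.* F x ℤ.+ s) (sumOver-*ˡ c xs F))

    sumOver-zero : ∀ (xs : List A) F → sumOver xs (λ x → 0ℤ ℤ.* F x) ≡ 0ℤ
    sumOver-zero xs F = sym (sumOver-*ˡ 0ℤ xs F)

    sumOver-++ : ∀ (xs ys : List A) F → sumOver (xs ++ ys) F ≡ sumOver xs F ℤ.+ sumOver ys F
    sumOver-++ []       ys F = sym (ℤ.+-identityˡ _)
    sumOver-++ (x ∷ xs) ys F = trans (cong (ℤ._+_ (F x)) (sumOver-++ xs ys F)) (sym (ℤ.+-assoc (F x) _ _))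

    sumOver-signed : {P Q : A → Set} (P? : ∀ x → Dec (P x)) (Q? : ∀ x → Dec (Q x)) {F : A → ℤ} →
                     (∀ x → P x → F x ≡ 1ℤ) → (∀ x → Q x → F x ≡ -1ℤ) →
                     (∀ x → P x → ¬ Q x) → (∀ x → ¬ P x → ¬ Q x → F x ≡ 0ℤ) →
                     ∀ xs → sumOver xs F ≡ ℤ.+ length (filter P? xs) ℤ.- ℤ.+ length (filter Q? xs)
    sumOver-signed P? Q? pos neg disjoint zer []       = refl
    sumOver-signed P? Q? pos neg disjoint zer (x ∷ xs)
      with sumOver-signed P? Q? pos neg disjoint zer xs | P? x | Q? x
    ... | ih | yes p | yes q = contradiction q (disjoint x p)
    ... | ih | yes p | no _  = trans (cong₂ ℤ._+_ (pos x p) ih)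
                                     (sym (ℤ.+-assoc 1ℤ (ℤ.+ length (filter P? xs)) (- (ℤ.+ length (filter Q? xs)))))
    ... | ih | no _  | yes q = trans (cong₂ ℤ._+_ (neg x q) ih)
                                     (arith (ℤ.+ length (filter P? xs)) (ℤ.+ length (filter Q? xs)))
      where
      arith : ∀ a b → -1ℤ ℤ.+ (a ℤ.- b) ≡ a ℤ.- (1ℤ ℤ.+ b)
      arith = ℤSolver.solve-∀
    ... | ih | no ¬p | no ¬q = trans (cong₂ ℤ._+_ (zer x ¬p ¬q) ih) (ℤ.+-identityˡ _)

  sumOver-map : {A B : Set} (g : A → B) → ∀ xs F → sumOver (map g xs) F ≡ sumOver xs (F ∘ g)
  sumOver-map g []       F = refl
  sumOver-map g (x ∷ xs) F = cong (ℤ._+_ (F (g x))) (sumOver-map g xs F)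

  sumOver-product : {A B C : Set} (g : A → B → C) → ∀ xs ys F →
                    sumOver (cartesianProductWith g xs ys) F ≡
                    sumOver xs (λ x → sumOver ys (λ y → F (g x y)))
  sumOver-product g []       ys F = refl
  sumOver-product g (x ∷ xs) ys F = trans (sumOver-++ (map (g x) ys) _ F)
    (cong₂ ℤ._+_ (sumOver-map (g x) ys F) (sumOver-product g xs ys F))

  sumOver-allSubsets : ∀ k (F : Subset (suc k) → ℤ) → sumOver (allSubsets (suc k)) F ≡
    sumOver (allSubsets k) (F ∘ (outside ∷_)) ℤ.+ sumOver (allSubsets k) (F ∘ (inside ∷_))
  sumOver-allSubsets k F = trans
    (sumOver-product _∷_ (outside ∷ inside ∷ []) (allSubsets k) F)
    (cong (ℤ._+_ (sumOver (allSubsets k) (F ∘ (outside ∷_)))) (ℤ.+-identityʳ _))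

  -- This is (-1)^|h| if h ⊆ d and 0 otherwise. The value 0 allows sums over all subsets, and hence
  -- over all digraphs, as in the definitions of `EE` and `EO`.
  rowSign : ∀ {k} → Subset k → Subset k → ℤ
  rowSign []            []            = 1ℤ
  rowSign (_       ∷ d) (outside ∷ h) = rowSign d h
  rowSign (inside  ∷ d) (inside  ∷ h) = - rowSign d h
  rowSign (outside ∷ d) (inside  ∷ h) = 0ℤ

  module _ {n : ℕ} where

    -- The map `ι` keeps the names of the vertices while the recursion removes leading columns; `ρ`
    -- does the same for rows in `arcs`.
    rowArcs : ∀ {k} → Fin n → Subset k → (Fin k → Fin n) → List (Edge n)
    rowArcs u []            ι = []
    rowArcs u (outside ∷ d) ι = rowArcs u d (ι ∘ suc)
    rowArcs u (inside  ∷ d) ι = (u , ι zero) ∷ rowArcs u d (ι ∘ suc)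

    arcs : ∀ {m} → Vec (Subset n) m → (Fin m → Fin n) → List (Edge n)
    arcs []      ρ = []
    arcs (d ∷ D) ρ = rowArcs (ρ zero) d id ++ arcs D (ρ ∘ suc)

    sign : ∀ {m} → Vec (Subset n) m → Vec (Subset n) m → ℤ
    sign []      []      = 1ℤ
    sign (d ∷ D) (h ∷ H) = rowSign d h ℤ.* sign D H

    -- The exponent picked by the monomial that takes the head of each arc in h
    -- and the tail of each other arc of d.

    rowExponent : ∀ {k} → Fin n → Subset k → Subset k → (Fin k → Fin n) → Vec ℕ n → Vec ℕ n
    rowExponent u []            []            ι α = α
    rowExponent u (outside ∷ d) (_       ∷ h) ι α = rowExponent u d h (ι ∘ suc) α
    rowExponent u (inside  ∷ d) (outside ∷ h) ι α = rowExponent u d h (ι ∘ suc) (bump α u)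
    rowExponent u (inside  ∷ d) (inside  ∷ h) ι α = rowExponent u d h (ι ∘ suc) (bump α (ι zero))

    exponent : ∀ {m} → Vec (Subset n) m → Vec (Subset n) m → (Fin m → Fin n) → Vec ℕ n → Vec ℕ n
    exponent []      []      ρ α = α
    exponent (d ∷ D) (h ∷ H) ρ α = exponent D H (ρ ∘ suc) (rowExponent (ρ zero) d h id α)

    -- The factors of the arcs with tail `u` are multiplied out: `h` records the arcs whose head is
    -- taken, each of which contributes a sign.
    expand-row : ∀ {k} u (d : Subset k) ι E α w →
                 expand (rowArcs u d ι ++ E) α w ≡
                 sumOver (allSubsets k) λ h → rowSign d h ℤ.* expand E (rowExponent u d h ι α) w
    expand-row u [] ι E α w = sym (trans (ℤ.+-identityʳ _) (ℤ.*-identityˡ _))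
    expand-row {suc k} u (outside ∷ d) ι E α w = begin
      expand (rowArcs u d (ι ∘ suc) ++ E) α w
        ≡⟨ expand-row u d (ι ∘ suc) E α w ⟩
      sumOver (allSubsets k) F
        ≡⟨ ℤ.+-identityʳ _ ⟨
      sumOver (allSubsets k) F ℤ.+ 0ℤ
        -- The subsets containing the column that is absent from `d` enter with coefficient 0.
        ≡⟨ cong (ℤ._+_ (sumOver (allSubsets k) F))
             (sumOver-zero (allSubsets k) (λ h → expand E (rowExponent u d h (ι ∘ suc) α) w)) ⟨
      sumOver (allSubsets k) F ℤ.+ sumOver (allSubsets k) (λ h → 0ℤ ℤ.* expand E (rowExponent u d h (ι ∘ suc) α) w)
        ≡⟨ sumOver-allSubsets k _ ⟨
      sumOver (allSubsets (suc k)) (λ h → rowSign (outside ∷ d) h ℤ.* expand E (rowExponent u (outside ∷ d) h ι α) w) ∎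
      where
      open ≡-Reasoning
      F : Subset k → ℤ
      F h = rowSign d h ℤ.* expand E (rowExponent u d h (ι ∘ suc) α) w
    expand-row {suc k} u (inside ∷ d) ι E α w = begin
      expand (rowArcs u d (ι ∘ suc) ++ E) (bump α u) w ℤ.- expand (rowArcs u d (ι ∘ suc) ++ E) (bump α (ι zero)) w
        ≡⟨ cong₂ ℤ._-_ (expand-row u d (ι ∘ suc) E (bump α u) w) (expand-row u d (ι ∘ suc) E (bump α (ι zero)) w) ⟩
      sumOver (allSubsets k) (F (bump α u)) ℤ.- sumOver (allSubsets k) (F (bump α (ι zero)))
        ≡⟨ cong (ℤ._+_ (sumOver (allSubsets k) (F (bump α u))))
             (trans (sym (ℤ.-1*i≡-i _)) (sumOver-*ˡ -1ℤ (allSubsets k) _)) ⟩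
      sumOver (allSubsets k) (F (bump α u)) ℤ.+ sumOver (allSubsets k) (λ h → -1ℤ ℤ.* F (bump α (ι zero)) h)
        ≡⟨ cong (ℤ._+_ (sumOver (allSubsets k) (F (bump α u)))) (sumOver-cong (allSubsets k) λ h →
             trans (ℤ.-1*i≡-i (F (bump α (ι zero)) h)) (ℤ.neg-distribˡ-* (rowSign d h) _)) ⟩
      sumOver (allSubsets k) (F (bump α u)) ℤ.+
      sumOver (allSubsets k) (λ h →
        - rowSign d h ℤ.* expand E (rowExponent u d h (ι ∘ suc) (bump α (ι zero))) w)
        ≡⟨ sumOver-allSubsets k _ ⟨
      sumOver (allSubsets (suc k)) (λ h → rowSign (inside ∷ d) h ℤ.* expand E (rowExponent u (inside ∷ d) h ι α) w) ∎
      where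
      open ≡-Reasoning
      F : Vec ℕ n → Subset k → ℤ
      F β h = rowSign d h ℤ.* expand E (rowExponent u d h (ι ∘ suc) β) w

    expand-arcs : ∀ {m} (D : Vec (Subset n) m) ρ α w →
                  expand (arcs D ρ) α w ≡
                  sumOver (allVecs (allSubsets n) m) λ H → sign D H ℤ.* w (exponent D H ρ α)
    expand-arcs [] ρ α w = sym (trans (ℤ.+-identityʳ _) (ℤ.*-identityˡ _))
    expand-arcs {suc m} (d ∷ D) ρ α w = begin
      expand (rowArcs (ρ zero) d id ++ arcs D (ρ ∘ suc)) α w
        ≡⟨ expand-row (ρ zero) d id (arcs D (ρ ∘ suc)) α w ⟩
      sumOver (allSubsets n) (λ h → rowSign d h ℤ.* expand (arcs D (ρ ∘ suc)) (β h) w)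
        ≡⟨ sumOver-cong (allSubsets n) (λ h → trans
             (cong (rowSign d h ℤ.*_) (expand-arcs D (ρ ∘ suc) (β h) w))
             (trans (sumOver-*ˡ (rowSign d h) (allVecs (allSubsets n) m) _)
               (sumOver-cong (allVecs (allSubsets n) m) λ H → sym (ℤ.*-assoc (rowSign d h) (sign D H) _)))) ⟩
      sumOver (allSubsets n) (λ h → sumOver (allVecs (allSubsets n) m) λ H →
        rowSign d h ℤ.* sign D H ℤ.* w (exponent D H (ρ ∘ suc) (β h)))
        ≡⟨ sumOver-product _∷_ (allSubsets n) (allVecs (allSubsets n) m) _ ⟨
      sumOver (allVecs (allSubsets n) (suc m)) (λ H → sign (d ∷ D) H ℤ.* w (exponent (d ∷ D) H ρ α)) ∎
      where
      open ≡-Reasoning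
      β : Subset n → Vec ℕ n
      β h = rowExponent (ρ zero) d h id α

  parity : ℕ → ℤ
  parity zero    = 1ℤ
  parity (suc k) = - parity k

  parity-+ : ∀ a b → parity (a + b) ≡ parity a ℤ.* parity b
  parity-+ zero    b = sym (ℤ.*-identityˡ _)
  parity-+ (suc a) b = trans (cong -_ (parity-+ a b)) (ℤ.neg-distribˡ-* (parity a) (parity b))

  parity-even : ∀ k → 2 ∣ k → parity k ≡ 1ℤ
  parity-odd  : ∀ k → ¬ 2 ∣ k → parity k ≡ -1ℤ
  parity-even zero          ev = refl
  parity-even (suc zero)    ev with s≤s () ← ∣⇒≤ ev
  parity-even (suc (suc k)) ev = trans (ℤ.neg-involutive (parity k)) (parity-even k (∣m+n∣m⇒∣n ev ∣-refl))
  parity-odd zero          od = contradiction (2 ∣0) od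
  parity-odd (suc zero)    od = refl
  parity-odd (suc (suc k)) od = trans (ℤ.neg-involutive (parity k)) (parity-odd k (od ∘ ∣m∣n⇒∣m+n ∣-refl))

  rowSign-⊆ : ∀ {k} (d h : Subset k) → h ⊆ d → rowSign d h ≡ parity ∣ h ∣
  rowSign-⊆ []            []            h⊆d = refl
  rowSign-⊆ (_       ∷ d) (outside ∷ h) h⊆d = rowSign-⊆ d h (drop-∷-⊆ h⊆d)
  rowSign-⊆ (inside  ∷ d) (inside  ∷ h) h⊆d = cong -_ (rowSign-⊆ d h (drop-∷-⊆ h⊆d))
  rowSign-⊆ (outside ∷ d) (inside  ∷ h) h⊆d with () ← h⊆d Vec.here

  rowSign-support : ∀ {k} (d h : Subset k) → rowSign d h ≡ 0ℤ ⊎ h ⊆ d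
  rowSign-support []            []            = inj₂ id
  rowSign-support (inside  ∷ d) (inside  ∷ h) with rowSign-support d h
  ... | inj₁ eq  = inj₁ (cong -_ eq)
  ... | inj₂ h⊆d = inj₂ (in⊆in h⊆d)
  rowSign-support (outside ∷ d) (inside  ∷ h) = inj₁ refl
  rowSign-support (_       ∷ d) (outside ∷ h) with rowSign-support d h
  ... | inj₁ eq  = inj₁ eq
  ... | inj₂ h⊆d = inj₂ (out⊆ h⊆d)

  module _ {n : ℕ} where

    sign-support : ∀ {m} (D H : Vec (Subset n) m) →
                   sign D H ≡ 0ℤ ⊎ (∀ v → lookup H v ⊆ lookup D v)
    sign-support []      []      = inj₂ λ ()
    sign-support (d ∷ D) (h ∷ H) with rowSign-support d h | sign-support D H
    ... | inj₁ eq  | _        = inj₁ (trans (cong (ℤ._* sign D H) eq) (ℤ.*-zeroˡ (sign D H)))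
    ... | inj₂ _   | inj₁ eq  = inj₁ (trans (cong (rowSign d h ℤ.*_) eq) (ℤ.*-zeroʳ (rowSign d h)))
    ... | inj₂ h⊆d | inj₂ H⊆D = inj₂ λ { zero → h⊆d ; (suc v) → H⊆D v }

    sign-⊆ : ∀ {m} (D H : Vec (Subset n) m) → (∀ v → lookup H v ⊆ lookup D v) →
             sign D H ≡ parity (Vec.sum (Vec.map ∣_∣ H))
    sign-⊆ []      []      H⊆D = refl
    sign-⊆ (d ∷ D) (h ∷ H) H⊆D = trans
      (cong₂ ℤ._*_ (rowSign-⊆ d h (H⊆D zero)) (sign-⊆ D H (H⊆D ∘ suc)))
      (sym (parity-+ ∣ h ∣ _))

    lookup-bump : ∀ (α : Vec ℕ n) u v → lookup (bump α u) v ≡ δ u v + lookup α v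
    lookup-bump α u v with u ≟ᶠ v
    ... | yes refl = lookup∘updateAt u α
    ... | no  u≢v  = lookup∘updateAt′ v u (u≢v ∘ sym) α

    -- The pushforward of `xs` along `ι`, evaluated at `v`.
    weigh : ∀ {k} → Vec ℕ k → (Fin k → Fin n) → Fin n → ℕ
    weigh []       ι v = 0
    weigh (x ∷ xs) ι v = δ (ι zero) v * x + weigh xs (ι ∘ suc) v

    weigh-outside : ∀ {k} (xs : Vec ℕ k) ι v → (∀ i → ι i ≢ v) → weigh xs ι v ≡ 0
    weigh-outside []       ι v ∉ι = refl
    weigh-outside (x ∷ xs) ι v ∉ι with ι zero ≟ᶠ v
    ... | yes eq = contradiction eq (∉ι zero)
    ... | no _   = weigh-outside xs (ι ∘ suc) v (∉ι ∘ suc)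

    weigh-injective : ∀ {k} (xs : Vec ℕ k) ι → Injective _≡_ _≡_ ι →
                      ∀ i → weigh xs ι (ι i) ≡ lookup xs i
    weigh-injective (x ∷ xs) ι inj zero with ι zero ≟ᶠ ι zero
    ... | yes _ = trans (cong₂ _+_ (ℕ.*-identityˡ x) (weigh-outside xs (ι ∘ suc) (ι zero)
                    λ i eq → case inj eq of λ ())) (ℕ.+-identityʳ x)
    ... | no ne = contradiction refl ne
    weigh-injective (x ∷ xs) ι inj (suc i) with ι zero ≟ᶠ ι (suc i)
    ... | yes eq = case inj eq of λ ()
    ... | no _   = weigh-injective xs (ι ∘ suc) (suc-injective ∘ inj) i

  ∣∷∣ : ∀ {k} b (p : Subset k) → ∣ b ∷ p ∣ ≡ bit b + ∣ p ∣
  ∣∷∣ true  p = refl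
  ∣∷∣ false p = refl

  module _ {n : ℕ} where

    -- Every arc of `d` gives a unit to `u`, except that those in `h` give it to their heads. The
    -- units lost by `u` stand on the left to avoid subtraction.
    lookup-rowExponent : ∀ {k} u (d h : Subset k) ι (α : Vec ℕ n) v → h ⊆ d →
      lookup (rowExponent u d h ι α) v + δ u v * ∣ h ∣ ≡
      lookup α v + δ u v * ∣ d ∣ + weigh (Vec.map bit h) ι v
    lookup-rowExponent u [] [] ι α v _ = sym (ℕ.+-identityʳ _)
    lookup-rowExponent u (outside ∷ d) (inside ∷ h) ι α v h⊆d with () ← h⊆d Vec.here
    lookup-rowExponent u (outside ∷ d) (outside ∷ h) ι α v h⊆d = trans
      (lookup-rowExponent u d h (ι ∘ suc) α v (drop-∷-⊆ h⊆d))
      (arith (lookup α v + δ u v * ∣ d ∣) (δ (ι zero) v) _)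
      where
      arith : ∀ x p w → x + w ≡ x + (p * 0 + w)
      arith = solve-∀
    lookup-rowExponent u (inside ∷ d) (outside ∷ h) ι α v h⊆d = trans
      (lookup-rowExponent u d h (ι ∘ suc) (bump α u) v (drop-∷-⊆ h⊆d))
      (trans (cong (λ x → x + δ u v * ∣ d ∣ + weigh (Vec.map bit h) (ι ∘ suc) v) (lookup-bump α u v))
             (arith (δ u v) (lookup α v) ∣ d ∣ (δ (ι zero) v) _))
      where
      arith : ∀ e a s p w → e + a + e * s + w ≡ a + e * (1 + s) + (p * 0 + w)
      arith = solve-∀
    lookup-rowExponent u (inside ∷ d) (inside ∷ h) ι α v h⊆d = begin
      x + e * (1 + ∣ h ∣)               ≡⟨ arith₁ x e ∣ h ∣ ⟩
      (x + e * ∣ h ∣) + e               ≡⟨ cong (_+ e)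
        (lookup-rowExponent u d h (ι ∘ suc) (bump α (ι zero)) v (drop-∷-⊆ h⊆d)) ⟩
      lookup (bump α (ι zero)) v + e * ∣ d ∣ + w + e
                                        ≡⟨ cong (λ y → y + e * ∣ d ∣ + w + e) (lookup-bump α (ι zero) v) ⟩
      δ (ι zero) v + lookup α v + e * ∣ d ∣ + w + e
                                        ≡⟨ arith₂ e (lookup α v) ∣ d ∣ (δ (ι zero) v) w ⟩
      lookup α v + e * (1 + ∣ d ∣) + (δ (ι zero) v * 1 + w) ∎
      where
      open ≡-Reasoning
      x = lookup (rowExponent u d h (ι ∘ suc) (bump α (ι zero))) v
      e = δ u v
      w = weigh (Vec.map bit h) (ι ∘ suc) v

      arith₁ : ∀ x e s → x + e * (1 + s) ≡ x + e * s + e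
      arith₁ = solve-∀

      arith₂ : ∀ e a s p w → p + a + e * s + w + e ≡ a + e * (1 + s) + (p * 1 + w)
      arith₂ = solve-∀

    lookup-exponent : ∀ {m} (D H : Vec (Subset n) m) ρ α v → (∀ i → lookup H i ⊆ lookup D i) →
      lookup (exponent D H ρ α) v + weigh (Vec.map ∣_∣ H) ρ v ≡
      lookup α v + weigh (Vec.map ∣_∣ D) ρ v + ∣ Vec.map (λ out → lookup out v) H ∣
    lookup-exponent []      []      ρ α v H⊆D = sym (ℕ.+-identityʳ _)
    lookup-exponent (d ∷ D) (h ∷ H) ρ α v H⊆D = begin
      x + (e * ∣ h ∣ + weigh (Vec.map ∣_∣ H) (ρ ∘ suc) v)
        ≡⟨ arith₁ x (e * ∣ h ∣) _ ⟩
      x + weigh (Vec.map ∣_∣ H) (ρ ∘ suc) v + e * ∣ h ∣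
        ≡⟨ cong (_+ e * ∣ h ∣) (lookup-exponent D H (ρ ∘ suc) β v (H⊆D ∘ suc)) ⟩
      lookup β v + W + ∣ col ∣ + e * ∣ h ∣
        ≡⟨ arith₂ (lookup β v) W ∣ col ∣ (e * ∣ h ∣) ⟩
      (lookup β v + e * ∣ h ∣) + W + ∣ col ∣
        ≡⟨ cong (λ y → y + W + ∣ col ∣) (lookup-rowExponent (ρ zero) d h id α v (H⊆D zero)) ⟩
      lookup α v + e * ∣ d ∣ + weigh (Vec.map bit h) id v + W + ∣ col ∣
        ≡⟨ cong (λ y → lookup α v + e * ∣ d ∣ + y + W + ∣ col ∣)
             (trans (weigh-injective (Vec.map bit h) id id v) (lookup-map v bit h)) ⟩
      lookup α v + e * ∣ d ∣ + bit (lookup h v) + W + ∣ col ∣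
        ≡⟨ arith₃ (lookup α v) (e * ∣ d ∣) (bit (lookup h v)) W ∣ col ∣ ⟩
      lookup α v + (e * ∣ d ∣ + W) + (bit (lookup h v) + ∣ col ∣)
        ≡⟨ cong (lookup α v + (e * ∣ d ∣ + W) +_) (∣∷∣ (lookup h v) col) ⟨
      lookup α v + (e * ∣ d ∣ + W) + ∣ lookup h v ∷ col ∣ ∎
      where
      open ≡-Reasoning
      β = rowExponent (ρ zero) d h id α
      x = lookup (exponent D H (ρ ∘ suc) β) v
      e = δ (ρ zero) v
      W = weigh (Vec.map ∣_∣ D) (ρ ∘ suc) v
      col = Vec.map (λ out → lookup out v) H

      arith₁ : ∀ x y z → x + (y + z) ≡ x + z + y
      arith₁ = solve-∀

      arith₂ : ∀ b w c y → b + w + c + y ≡ (b + y) + w + c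
      arith₂ = solve-∀

      arith₃ : ∀ a y b w c → a + y + b + w + c ≡ a + (y + w) + (b + c)
      arith₃ = solve-∀

  module _ {n : ℕ} (D : Digraph n) where

    origin outDegrees : Vec ℕ n
    origin     = replicate n 0
    outDegrees = Vec.map ∣_∣ D

    contribution : Digraph n → ℤ
    contribution H = sign D H ℤ.* indicator (conditions ⊥ outDegrees) (exponent D H id origin)

    -- Taking all tails yields the out-degrees of `D`, and each arc of `H` moves one unit from its
    -- tail to its head. So `H` yields the monomial of out-degrees exactly when it is balanced.
    exponent-balance : ∀ H → SpanningSubgraph D H → ∀ v →
      lookup (exponent D H id origin) v + outDegree H v ≡ lookup outDegrees v + inDegree H v
    exponent-balance H H⊆D v = begin
      lookup (exponent D H id origin) v + outDegree H v
        ≡⟨ cong (lookup (exponent D H id origin) v +_)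
             (trans (weigh-injective (Vec.map ∣_∣ H) id id v) (lookup-map v ∣_∣ H)) ⟨
      lookup (exponent D H id origin) v + weigh (Vec.map ∣_∣ H) id v
        ≡⟨ lookup-exponent D H id origin v H⊆D ⟩
      lookup origin v + weigh outDegrees id v + inDegree H v
        ≡⟨ cong (_+ inDegree H v) (cong₂ _+_ (lookup-replicate v 0) (weigh-injective outDegrees id id v)) ⟩
      lookup outDegrees v + inDegree H v ∎
      where open ≡-Reasoning

    contribution-eulerian : ∀ H → EulerianSubgraph D H → contribution H ≡ parity (size H)
    contribution-eulerian H (H⊆D , bal) = trans
      (cong₂ ℤ._*_ (sign-⊆ D H H⊆D)
        (trans (cong (indicator (conditions ⊥ outDegrees))
                 (Pointwise-≡⇒≡ (ext λ v → ℕ.+-cancelʳ-≡ (inDegree H v) _ _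
                   (trans (cong (lookup (exponent D H id origin) v +_) (sym (bal v)))
                          (exponent-balance H H⊆D v)))))
               (indicator-refl ⊥ outDegrees)))
      (ℤ.*-identityʳ _)

    -- Either an arc of `H` is missing from `D` and the sign is 0, or `H` is unbalanced and its
    -- monomial is not the one extracted.
    contribution-other : ∀ H → ¬ EulerianSubgraph D H → contribution H ≡ 0ℤ
    contribution-other H ¬eul with sign-support D H
    ... | inj₁ eq  = trans (cong (ℤ._* w) eq) (ℤ.*-zeroˡ w)
      where w = indicator (conditions ⊥ outDegrees) (exponent D H id origin)
    ... | inj₂ H⊆D = trans (cong (sign D H ℤ.*_) (indicator-≢ outDegrees (exponent D H id origin)
      λ eq → ¬eul (H⊆D , λ v → ℕ.+-cancelˡ-≡ (lookup outDegrees v) _ _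
        (trans (cong (λ β → lookup β v + outDegree H v) (sym eq)) (exponent-balance H H⊆D v)))))
      (ℤ.*-zeroʳ (sign D H))

    parity-count : sumOver (allDigraphs n) contribution ≡ ℤ.+ EE D ℤ.- ℤ.+ EO D
    parity-count = sumOver-signed (evenEulerian? D) (oddEulerian? D)
      (λ H (eul , ev) → trans (contribution-eulerian H eul) (parity-even (size H) ev))
      (λ H (eul , od) → trans (contribution-eulerian H eul) (parity-odd (size H) od))
      (λ H (_ , ev) (_ , od) → od ev)
      (λ H ¬ev ¬od → contribution-other H λ eul → ¬od (eul , λ ev → ¬ev (eul , ev)))
      (allDigraphs n)

    arcs-nonVanishing : EE D ≢ EO D → NonVanishing (arcs D id) origin outDegrees
    arcs-nonVanishing EE≢EO eq = EE≢EO (ℤ.+-injective (ℤ.i-j≡0⇒i≡j (ℤ.+ EE D) (ℤ.+ EO D) (trans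
      (sym (trans (expand-arcs D id origin (indicator (conditions ⊥ outDegrees)))
                  parity-count))
      eq)))

  ∈-rowArcs : ∀ {n k} u (d : Subset k) (ι : Fin k → Fin n) {v} → v ∈ d → (u , ι v) ∈ˡ rowArcs u d ι
  ∈-rowArcs u (inside  ∷ d) ι Vec.here       = here refl
  ∈-rowArcs u (inside  ∷ d) ι (Vec.there v∈) = there (∈-rowArcs u d (ι ∘ suc) v∈)
  ∈-rowArcs u (outside ∷ d) ι (Vec.there v∈) = ∈-rowArcs u d (ι ∘ suc) v∈

  ∈-arcs : ∀ {n m} (D : Vec (Subset n) m) ρ i {v} → v ∈ lookup D i → (ρ i , v) ∈ˡ arcs D ρ
  ∈-arcs (d ∷ D) ρ zero    v∈ = ∈-++⁺ˡ (∈-rowArcs (ρ zero) d id v∈)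
  ∈-arcs (d ∷ D) ρ (suc i) v∈ = ∈-++⁺ʳ (rowArcs (ρ zero) d id) (∈-arcs D (ρ ∘ suc) i v∈)

  hasATOrientation⇒paintable : ∀ {n} (G : Graph n) k → HasATOrientation G k → Paintable G (λ _ → k)
  hasATOrientation⇒paintable G k (D , (or , EE≢EO) , out<k) =
    surplus-wins G _ (λ _ → k) ⊥ ℕ.≤-refl record
      { edges        = arcs D id
      ; start        = origin D
      ; target       = outDegrees D
      ; nonVanishing = arcs-nonVanishing D EE≢EO
      ; complete     = λ u v _ _ uv → Sum.map (∈-arcs D id u) (∈-arcs D id v)
                                              (IsOrientation.adj⇒arc or u v uv)
      ; target-<     = λ v _ → subst (_< k) (sym (lookup-map v ∣_∣ D)) (out<k v)
      }

  χP≤AT : ∀ {n} (G : Graph n) → χP G ≤ AT G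
  χP≤AT G = proj₂ (proj₂ (χP-least G)) (AT G)
    (hasATOrientation⇒paintable G (AT G) (proj₁ (proj₂ (AT-least G))))

-- Orienting a multigraph so that in-degrees and out-degrees differ by at most one.

module BalancedOrientation where

  open FiniteSums
  open GraphPolynomial using (Edge)
  open import Data.Fin.Base using (Fin; zero; suc)
  open import Data.Fin.Properties using () renaming (_≟_ to _≟ᶠ_)
  open import Data.List.Base using (List; []; _∷_; _++_; length; concat; tabulate; replicate)
  open import Data.Nat.Base using (ℕ; zero; suc; _+_; _*_; _≤_; z≤n; s≤s; s≤s⁻¹)
  import Data.Nat.Properties as ℕ
  open import Data.Nat.Tactic.RingSolver using (solve-∀)
  open import Data.Product.Base using (∃; ∃₂; _×_; _,_; proj₁; proj₂; swap)
  open import Data.Sum.Base using (_⊎_; inj₁; inj₂)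
  open import Function.Base using (_∘_)
  open import Relation.Binary.PropositionalEquality
    using (_≡_; refl; sym; trans; cong; cong₂; subst; subst₂; module ≡-Reasoning)
  open import Relation.Nullary.Decidable using (yes; no)

  module _ {n : ℕ} where

    weight : (Fin n → Fin n → ℕ) → List (Edge n) → ℕ
    weight φ []            = 0
    weight φ ((u , v) ∷ E) = φ u v + weight φ E

    -- E and O are the same multigraph up to the directions of their edges.

    _≈_ : List (Edge n) → List (Edge n) → Set
    E ≈ O = ∀ φ → (∀ u v → φ u v ≡ φ v u) → weight φ E ≡ weight φ O

    outs ins : List (Edge n) → Fin n → ℕ
    outs E v = weight (λ x y → δ x v) E
    ins  E v = weight (λ x y → δ y v) E

    Balanced : List (Edge n) → Set
    Balanced E = ∀ v → outs E v ≤ suc (ins E v) × ins E v ≤ suc (outs E v)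

    incidence : Fin n → Fin n → Fin n → ℕ
    incidence v x y = δ x v + δ y v

    weight-+ : ∀ φ ψ E → weight (λ x y → φ x y + ψ x y) E ≡ weight φ E + weight ψ E
    weight-+ φ ψ []            = refl
    weight-+ φ ψ ((u , v) ∷ E) = trans (cong (φ u v + ψ u v +_) (weight-+ φ ψ E))
                                       (arith (φ u v) (ψ u v) _ _)
      where
      arith : ∀ a b c d → a + b + (c + d) ≡ a + c + (b + d)
      arith = solve-∀

    -- Subdividing an arc at `b` gives `b` one more arc in each direction and changes nothing at `a`
    -- and `c`.
    splice : ∀ a b c O → Balanced ((a , c) ∷ O) → Balanced ((a , b) ∷ (b , c) ∷ O)
    splice a b c O bal v = shift (proj₁ (bal v)) , shift′ (proj₂ (bal v))
      where
      arith : ∀ a b o → b + (a + o) ≡ a + (b + o)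
      arith = solve-∀
      shift : δ a v + outs O v ≤ suc (δ c v + ins O v) →
              δ a v + (δ b v + outs O v) ≤ suc (δ b v + (δ c v + ins O v))
      shift le = subst₂ _≤_ (arith (δ a v) (δ b v) (outs O v)) (ℕ.+-suc (δ b v) _) (ℕ.+-monoʳ-≤ (δ b v) le)
      shift′ : δ c v + ins O v ≤ suc (δ a v + outs O v) →
               δ b v + (δ c v + ins O v) ≤ suc (δ a v + (δ b v + outs O v))
      shift′ le = ℕ.≤-trans (ℕ.+-monoʳ-≤ (δ b v) le) (ℕ.≤-reflexive
        (trans (ℕ.+-suc (δ b v) _) (cong suc (arith (δ a v) (δ b v) (outs O v)))))

    rotate : ∀ e f O → Balanced (e ∷ f ∷ O) → Balanced (f ∷ e ∷ O)
    rotate (a , b) (c , d) O bal v = subst₂ (λ x y → x ≤ suc y × y ≤ suc x)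
      (arith (δ a v) (δ c v) (outs O v)) (arith (δ b v) (δ d v) (ins O v)) (bal v)
      where
      arith : ∀ a b o → a + (b + o) ≡ b + (a + o)
      arith = solve-∀

    -- The absence of an edge at `b` is expressed by a symmetric weight, so that it passes to every
    -- reorientation by `≈`; see `isolated`.
    extract : ∀ b E → (∃₂ λ c E₁ → E ≈ ((b , c) ∷ E₁) × length E ≡ suc (length E₁))
                    ⊎ weight (incidence b) E ≡ 0
    extract b []            = inj₂ refl
    extract b ((u , v) ∷ E) with u ≟ᶠ b | v ≟ᶠ b
    ... | yes refl | _        = inj₁ (v , E , (λ φ _ → refl) , refl)
    ... | no _     | yes refl = inj₁ (u , E , (λ φ sy → cong (_+ weight φ E) (sy u b)) , refl)
    ... | no _     | no _     with extract b E
    ...   | inj₂ eq = inj₂ eq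
    ...   | inj₁ (c , E₁ , E≈ , len) = inj₁ (c , (u , v) ∷ E₁
        , (λ φ sy → trans (cong (φ u v +_) (E≈ φ sy)) (arith (φ u v) (φ b c) (weight φ E₁)))
        , cong suc len)
      where
      arith : ∀ a b o → a + (b + o) ≡ b + (a + o)
      arith = solve-∀

    isolated : ∀ E O {v} → E ≈ O → weight (incidence v) E ≡ 0 → outs O v ≡ 0 × ins O v ≡ 0
    isolated E O {v} E≈O eq = ℕ.m+n≡0⇒m≡0 _ sum≡0 , ℕ.m+n≡0⇒n≡0 (outs O v) sum≡0
      where
      sum≡0 : outs O v + ins O v ≡ 0
      sum≡0 = trans (sym (weight-+ (λ x y → δ x v) (λ x y → δ y v) O))
        (trans (sym (E≈O (incidence v) λ x y → ℕ.+-comm (δ x v) (δ y v))) eq)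

    -- The new arc is the only one at its ends, where it creates a difference of at most one.
    balanced-∷ : ∀ {a b O} → outs O a ≡ 0 × ins O a ≡ 0 → outs O b ≡ 0 × ins O b ≡ 0 →
                 Balanced O → Balanced ((a , b) ∷ O)
    balanced-∷ {a} {b} {O} (oa , ia) (ob , ib) bal v with a ≟ᶠ v in eqa | b ≟ᶠ v in eqb
    ... | yes refl | no _     rewrite oa | ia = s≤s z≤n , z≤n
    ... | yes refl | yes refl rewrite oa | ia = s≤s z≤n , s≤s z≤n
    ... | no _     | yes refl rewrite ob | ib = z≤n , s≤s z≤n
    ... | no _     | no _     = bal v

    -- Two edges a-b and b-c are replaced by a single edge a-c, whose direction
    -- is then given to both.  When no edge meets another end of the first one,
    -- its direction does not matter.

    balanceHead : ∀ k e E → length E ≤ k →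
                  ∃ λ O → E ≈ O × (Balanced (e ∷ O) ⊎ Balanced (swap e ∷ O))
    balance     : ∀ k E → length E ≤ k → ∃ λ O → E ≈ O × Balanced O

    balance k       []      le       = [] , (λ _ _ → refl) , λ v → z≤n , z≤n
    balance (suc k) (e ∷ E) (s≤s le) with balanceHead k e E le
    ... | O , E≈O , inj₁ bal = e ∷ O , (λ φ sy → cong (φ _ _ +_) (E≈O φ sy)) , bal
    ... | O , E≈O , inj₂ bal = swap e ∷ O , (λ φ sy → cong₂ _+_ (sy _ _) (E≈O φ sy)) , bal

    balanceHead k (a , b) E le with extract b E
    balanceHead (suc k) (a , b) E le | inj₁ (c , E₁ , E≈ , len)
      with balanceHead k (a , c) E₁ (s≤s⁻¹ (subst (_≤ suc k) len le))
    ... | O , E₁≈O , inj₁ bal = (b , c) ∷ O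
        , (λ φ sy → trans (E≈ φ sy) (cong (φ b c +_) (E₁≈O φ sy))) , inj₁ (splice a b c O bal)
    -- The auxiliary edge was directed from `c` to `a`, so the path is c, b, a and the first edge
    -- gets reversed.
    ... | O , E₁≈O , inj₂ bal = (c , b) ∷ O
        , (λ φ sy → trans (E≈ φ sy) (cong₂ _+_ (sy b c) (E₁≈O φ sy)))
        , inj₂ (rotate (c , b) (b , a) O (splice c b a O bal))
    balanceHead zero (a , b) E le | inj₁ (c , E₁ , E≈ , len) with () ← subst (_≤ 0) len le
    balanceHead k (a , b) E le | inj₂ b-isolated with extract a E
    balanceHead (suc k) (a , b) E le | inj₂ b-isolated | inj₁ (c , E₁ , E≈ , len)
      with balanceHead k (c , b) E₁ (s≤s⁻¹ (subst (_≤ suc k) len le))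
    ... | O , E₁≈O , inj₁ bal = (c , a) ∷ O
        , (λ φ sy → trans (E≈ φ sy) (cong₂ _+_ (sy a c) (E₁≈O φ sy)))
        , inj₁ (rotate (c , a) (a , b) O (splice c a b O bal))
    ... | O , E₁≈O , inj₂ bal = (a , c) ∷ O
        , (λ φ sy → trans (E≈ φ sy) (cong (φ a c +_) (E₁≈O φ sy))) , inj₂ (splice b a c O bal)
    balanceHead zero (a , b) E le | inj₂ _ | inj₁ (c , E₁ , E≈ , len) with () ← subst (_≤ 0) len le
    balanceHead k (a , b) [] le | inj₂ b-isolated | inj₂ a-isolated =
      [] , (λ _ _ → refl) , inj₁ (balanced-∷ {a} {b} {O = []} (refl , refl) (refl , refl) λ v → z≤n , z≤n)
    -- The first edge forms a component of its own; the other edges are oriented separately,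
    -- starting from `e`.
    balanceHead (suc k) (a , b) E@(e ∷ E₁) (s≤s le) | inj₂ b-isolated | inj₂ a-isolated
      with balanceHead k e E₁ le
    ... | O , E≈O , inj₁ bal = e ∷ O , eq , inj₁
        (balanced-∷ {a} {b} {O = e ∷ O} (isolated E (e ∷ O) eq a-isolated) (isolated E (e ∷ O) eq b-isolated) bal)
      where
      eq : E ≈ (e ∷ O)
      eq φ sy = cong (φ _ _ +_) (E≈O φ sy)
    ... | O , E≈O , inj₂ bal = swap e ∷ O , eq , inj₁
        (balanced-∷ {a} {b} {O = swap e ∷ O}
          (isolated E (swap e ∷ O) eq a-isolated) (isolated E (swap e ∷ O) eq b-isolated) bal)
      where
      eq : E ≈ (swap e ∷ O)
      eq φ sy = cong₂ _+_ (sy _ _) (E≈O φ sy)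

    weight-++ : ∀ φ E F → weight φ (E ++ F) ≡ weight φ E + weight φ F
    weight-++ φ []            F = refl
    weight-++ φ ((u , v) ∷ E) F = trans (cong (φ u v +_) (weight-++ φ E F)) (sym (ℕ.+-assoc (φ u v) _ _))

    weight-concat : ∀ φ {k} (Es : Fin k → List (Edge n)) →
                    weight φ (concat (tabulate Es)) ≡ sum (weight φ ∘ Es)
    weight-concat φ {zero}  Es = refl
    weight-concat φ {suc k} Es = trans (weight-++ φ (Es zero) _)
      (cong (weight φ (Es zero) +_) (weight-concat φ (Es ∘ suc)))

    weight-replicate : ∀ φ k u v → weight φ (replicate k (u , v)) ≡ k * φ u v
    weight-replicate φ zero    u v = refl
    weight-replicate φ (suc k) u v = cong (φ u v +_) (weight-replicate φ k u v)

    edgesOf : (Fin n → Fin n → ℕ) → List (Edge n)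
    edgesOf M = concat (tabulate λ u → concat (tabulate λ v → replicate (M u v) (u , v)))

    weight-edgesOf : ∀ φ M → weight φ (edgesOf M) ≡ sum (λ u → sum λ v → M u v * φ u v)
    weight-edgesOf φ M = trans (weight-concat φ {n} _) (sum-cong-≗ λ u →
      trans (weight-concat φ {n} _) (sum-cong-≗ λ v → weight-replicate φ (M u v) u v))

    sum-weight : ∀ {k} (φ : Fin k → Fin n → Fin n → ℕ) E →
                 sum (λ i → weight (φ i) E) ≡ weight (λ x y → sum λ i → φ i x y) E
    sum-weight {k} φ []            = sum-replicate-zero k
    sum-weight     φ ((u , v) ∷ E) = trans (∑-distrib-+ (λ i → φ i u v) _)
      (cong ((sum λ i → φ i u v) +_) (sum-weight φ E))

    weight-cong : ∀ {φ ψ} → (∀ x y → φ x y ≡ ψ x y) → ∀ E → weight φ E ≡ weight ψ E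
    weight-cong eq []            = refl
    weight-cong eq ((u , v) ∷ E) = cong₂ _+_ (eq u v) (weight-cong eq E)

    single : Fin n → Fin n → Fin n → Fin n → ℕ
    single u v x y = δ x u * δ y v

    weight-single-edgesOf : ∀ M u v → weight (single u v) (edgesOf M) ≡ M u v
    weight-single-edgesOf M u v = begin
      weight (single u v) (edgesOf M)
        ≡⟨ weight-edgesOf (single u v) M ⟩
      sum (λ x → sum λ y → M x y * (δ x u * δ y v))
        ≡⟨ sum-cong-≗ (λ x → trans
             (sum-cong-≗ λ y → trans (cong₂ (λ p q → M x y * (p * q)) (δ-sym x u) (δ-sym y v))
                                     (arith (M x y) (δ u x) (δ v y)))
             (sum-δ v (λ y → δ u x * M x y))) ⟩
      sum (λ x → δ u x * M x v)
        ≡⟨ sum-δ u (λ x → M x v) ⟩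
      M u v ∎
      where
      open ≡-Reasoning
      arith : ∀ m p q → m * (p * q) ≡ q * (p * m)
      arith = solve-∀

    -- The matrix form of `balance`, with entries as multiplicities. The number of edges joining `u`
    -- and `v` in either direction is a symmetric weight, hence preserved by `≈`.
    balancedOrientation : ∀ (M : Fin n → Fin n → ℕ) → ∃ λ (a : Fin n → Fin n → ℕ) →
      (∀ u v → a u v + a v u ≡ M u v + M v u) × (∀ v → sum (λ u → a v u) ≤ suc (sum λ u → a u v))
    balancedOrientation M with balance _ (edgesOf M) ℕ.≤-refl
    ... | O , E≈O , bal = (λ u v → weight (single u v) O)
      , (λ u v → begin
           weight (single u v) O + weight (single v u) O
             ≡⟨ weight-+ (single u v) (single v u) O ⟨
           weight (λ x y → single u v x y + single v u x y) O
             ≡⟨ E≈O _ (λ x y → arith (δ x u) (δ y v) (δ x v) (δ y u)) ⟨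
           weight (λ x y → single u v x y + single v u x y) (edgesOf M)
             ≡⟨ weight-+ (single u v) (single v u) (edgesOf M) ⟩
           weight (single u v) (edgesOf M) + weight (single v u) (edgesOf M)
             ≡⟨ cong₂ _+_ (weight-single-edgesOf M u v) (weight-single-edgesOf M v u) ⟩
           M u v + M v u ∎)
      , λ v → subst₂ (λ x y → x ≤ suc y)
          (sym (trans (sum-weight (λ u → single v u) O) (weight-cong (λ x y → sum-δ-const y (δ x v)) O)))
          (sym (trans (sum-weight (λ u → single u v) O) (weight-cong (λ x y → sum-δ x (λ _ → δ y v)) O)))
          (proj₁ (bal v))
      where
      open ≡-Reasoning
      arith : ∀ a b c d → a * b + c * d ≡ d * c + b * a
      arith = solve-∀

-- Layered orientations have no odd Eulerian subgraphs.

module LayeredOrientation where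

  open FiniteSums
  open import Data.Bool.Base using (Bool; true; false)
  open import Data.Fin.Base using (Fin; zero; suc)
  open import Data.Fin.Subset using (Subset; ⊥; inside; outside; _∈_; ∣_∣)
  open import Data.Fin.Subset.Properties using (∉⊥)
  open import Data.List.Base using ([]; _∷_; length)
  open import Data.List.Membership.Propositional using () renaming (_∈_ to _∈ˡ_)
  open import Data.List.Membership.Propositional.Properties using (∈-filter⁺)
  open import Data.List.Properties using (filter-none)
  import Data.List.Relation.Unary.All as All
  open import Data.List.Relation.Unary.Any using (here; there)
  open import Data.Nat.Base using (ℕ; zero; suc; _+_; _*_; _≤_; _<_; z≤n; s≤s)
  open import Data.Nat.Divisibility using (_∣_; _∣0; divides)
  import Data.Nat.Properties as ℕ
  open import Data.Nat.Tactic.RingSolver using (solve-∀)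
  open import Data.Product.Base using (_×_; _,_)
  open import Data.Sum.Base using (_⊎_; inj₁; inj₂)
  open import Data.Vec.Base as Vec using (Vec; []; _∷_; lookup; tabulate; replicate)
  open import Data.Vec.Properties
    using (lookup-map; lookup-replicate; lookup∘tabulate; []=⇒lookup; lookup⇒[]=)
  open import Function.Base using (_∘_)
  open import Relation.Binary.PropositionalEquality
    using (_≡_; _≢_; refl; sym; trans; cong; subst; module ≡-Reasoning)
  open import Relation.Nullary.Decidable using (yes; no; does; dec-true)
  open import Relation.Nullary.Negation using (contradiction)

  ∣∣-sum : ∀ {n} (S : Subset n) → ∣ S ∣ ≡ sum (λ v → bit (lookup S v))
  ∣∣-sum []            = refl
  ∣∣-sum (inside  ∷ S) = cong suc (∣∣-sum S)
  ∣∣-sum (outside ∷ S) = ∣∣-sum S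

  vecSum-sum : ∀ {n} (xs : Vec ℕ n) → Vec.sum xs ≡ sum (lookup xs)
  vecSum-sum []       = refl
  vecSum-sum (x ∷ xs) = cong (x +_) (vecSum-sum xs)

  module _ {n : ℕ} (H : Digraph n) where

    entry : Fin n → Fin n → ℕ
    entry u v = bit (lookup (lookup H u) v)

    inDegree-sum : ∀ v → inDegree H v ≡ sum (λ u → entry u v)
    inDegree-sum v = trans (∣∣-sum (inNeighbours H v)) (sum-cong-≗ λ u → cong bit (lookup-map u _ H))

    size-sum : size H ≡ sum (λ u → sum (entry u))
    size-sum = trans (vecSum-sum (Vec.map ∣_∣ H))
      (sum-cong-≗ λ u → trans (lookup-map u ∣_∣ H) (∣∣-sum (lookup H u)))

    module _ (bal : ∀ v → outDegree H v ≡ inDegree H v) where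

      -- By balance, each vertex is the tail of as many arcs as it is the head of, so it contributes
      -- equally to both sums.
      tails-heads : ∀ (g : Fin n → ℕ) →
                    sum (λ u → sum λ v → entry u v * g u) ≡ sum (λ u → sum λ v → entry u v * g v)
      tails-heads g = begin
        sum (λ u → sum λ v → entry u v * g u)
          ≡⟨ sum-cong-≗ (λ u → sym (*-distribʳ-sum (g u) (entry u))) ⟩
        sum (λ u → sum (entry u) * g u)
          ≡⟨ sum-cong-≗ (λ u → cong (_* g u) (trans (sym (∣∣-sum (lookup H u))) (trans (bal u) (inDegree-sum u)))) ⟩
        sum (λ v → sum (λ u → entry u v) * g v)
          ≡⟨ sum-cong-≗ (λ v → *-distribʳ-sum (g v) (λ u → entry u v)) ⟩
        sum (λ v → sum λ u → entry u v * g v)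
          ≡⟨ ∑-comm (λ v u → entry u v * g v) ⟩
        sum (λ u → sum λ v → entry u v * g v) ∎
        where open ≡-Reasoning

      -- A balanced digraph whose arcs never increase ρ only has arcs within the
      -- levels of ρ; if these join different sides, tails and heads on a given
      -- side are equinumerous and together account for all arcs.

      layered-even : ∀ (ρ : Fin n → ℕ) (side : Fin n → Bool) →
        (∀ u v → Arc H u v → ρ v < ρ u ⊎ (ρ u ≡ ρ v × side u ≢ side v)) → 2 ∣ size H
      layered-even ρ side layered = divides X (begin
        size H                                          ≡⟨ size-sum ⟩
        sum (λ u → sum (entry u))                       ≡⟨ sum-cong-≗ (λ u → sum-cong-≗ (one-side u)) ⟩
        sum (λ u → sum λ v → entry u v * bit (side u) + entry u v * bit (side v))
          ≡⟨ sum-cong-≗ (λ u → ∑-distrib-+ _ (λ v → entry u v * bit (side v))) ⟩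
        sum (λ u → sum (λ v → entry u v * bit (side u)) + sum (λ v → entry u v * bit (side v)))
          ≡⟨ ∑-distrib-+ _ (λ u → sum (λ v → entry u v * bit (side v))) ⟩
        X + sum (λ u → sum λ v → entry u v * bit (side v))
          ≡⟨ cong (X +_) (tails-heads (bit ∘ side)) ⟨
        X + X                                           ≡⟨ arith X ⟩
        X * 2 ∎)
        where
        open ≡-Reasoning
        X = sum (λ u → sum λ v → entry u v * bit (side u))

        arith : ∀ x → x + x ≡ x * 2
        arith = solve-∀

        descends : ∀ u v → entry u v * ρ v ≤ entry u v * ρ u
        descends u v with lookup (lookup H u) v in eq
        ... | false = z≤n
        ... | true with layered u v (lookup⇒[]= v (lookup H u) eq)
        ...   | inj₁ lt       = ℕ.*-monoʳ-≤ 1 (ℕ.<⇒≤ lt)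
        ...   | inj₂ (eq , _) = ℕ.≤-reflexive (cong (1 *_) (sym eq))

        level : ∀ u v → entry u v * ρ v ≡ entry u v * ρ u
        -- The total of `ρ` over tails equals that over heads, and no arc goes up. Hence equality
        -- holds in each row sum, and then in each entry.
        level u = sum-tight (descends u) (ℕ.≤-reflexive (sym (sum-tight (λ u → sum-mono (descends u))
          (ℕ.≤-reflexive (tails-heads ρ)) u)))

        one-side : ∀ u v → entry u v ≡ entry u v * bit (side u) + entry u v * bit (side v)
        one-side u v with lookup (lookup H u) v in eq | level u v
        ... | false | _   = refl
        ... | true  | lev with layered u v (lookup⇒[]= v (lookup H u) eq)
        ...   | inj₁ lt         = contradiction (ℕ.*-cancelˡ-≡ _ _ 1 lev) (ℕ.<⇒≢ lt)
        ...   | inj₂ (_ , diff) with side u | side v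
        ...     | true  | true  = contradiction refl diff
        ...     | true  | false = refl
        ...     | false | true  = refl
        ...     | false | false = contradiction refl diff

  layered⇒EO≡0 : ∀ {n} (D : Digraph n) (ρ : Fin n → ℕ) (side : Fin n → Bool) →
    (∀ u v → Arc D u v → ρ v < ρ u ⊎ (ρ u ≡ ρ v × side u ≢ side v)) → EO D ≡ 0
  layered⇒EO≡0 {n} D ρ side layered = cong length (filter-none (oddEulerian? D)
    (All.universal (λ H ((H⊆D , bal) , odd) →
      odd (layered-even H bal ρ side λ u v uv → layered u v (H⊆D u uv))) (allDigraphs n)))

  -- The empty subgraph is Eulerian and even.
  EE≢0 : ∀ {n} (D : Digraph n) → EE D ≢ 0
  EE≢0 {n} D = nonempty (∈-filter⁺ (evenEulerian? D) (∈-allDigraphs ∅)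
    ((∅⊆ , λ v → trans (∅-out v) (sym (∅-in v))) , subst (2 ∣_) (sym ∅-size) (2 ∣0)))
    where
    ∅ : Digraph n
    ∅ = replicate n ⊥

    nonempty : ∀ {A : Set} {x : A} {xs} → x ∈ˡ xs → length xs ≢ 0
    nonempty (here _)  ()
    nonempty (there _) ()

    ∅-entry : ∀ u v → entry ∅ u v ≡ 0
    ∅-entry u v rewrite lookup-replicate u (⊥ {n}) | lookup-replicate v outside = refl

    ∅⊆ : SpanningSubgraph D ∅
    ∅⊆ v x∈ = contradiction (subst (_ ∈_) (lookup-replicate v ⊥) x∈) ∉⊥

    ∅-out : ∀ v → outDegree ∅ v ≡ 0
    ∅-out v = trans (∣∣-sum (lookup ∅ v)) (trans (sum-cong-≗ (∅-entry v)) (sum-replicate-zero n))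

    ∅-in : ∀ v → inDegree ∅ v ≡ 0
    ∅-in v = trans (inDegree-sum ∅ v)
      (trans (sum-cong-≗ λ u → ∅-entry u v) (sum-replicate-zero n))

    ∅-size : size ∅ ≡ 0
    ∅-size = trans (size-sum ∅) (trans (sum-cong-≗ λ u → trans (sym (∣∣-sum (lookup ∅ u))) (∅-out u))
      (sum-replicate-zero n))

  module _ {n : ℕ} (G : Graph n) where

    adjacency : Fin n → Fin n → ℕ
    adjacency u v = bit (does (adj? G u v))

    -- Arcs are numbers so that layers can be added up. The field `oriented` bounds each sum of
    -- opposite entries by 1, which makes the entries 0 or 1 and the digraph asymmetric.
    record LayeredOrientation (s : ℕ) : Set where
      field
        arc      : Fin n → Fin n → ℕ
        oriented : ∀ u v → arc u v + arc v u ≡ adjacency u v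
        rank     : Fin n → ℕ
        side     : Fin n → Bool
        layered  : ∀ u v → 0 < arc u v → rank v < rank u ⊎ (rank u ≡ rank v × side u ≢ side v)
        outs-≤   : ∀ u → sum (arc u) ≤ s

    layered⇒AT : ∀ {s} → LayeredOrientation s → HasATOrientation G (suc s)
    layered⇒AT {s} L = D , (isOrientation , EE≢EO) , out<
      where
      open LayeredOrientation L

      positive : ℕ → Bool
      positive zero    = false
      positive (suc _) = true

      D : Digraph n
      D = tabulate λ u → tabulate λ v → positive (arc u v)

      lookup-D : ∀ u v → lookup (lookup D u) v ≡ positive (arc u v)
      lookup-D u v = trans (cong (λ S → lookup S v) (lookup∘tabulate (λ u → tabulate λ v → positive (arc u v)) u))
                           (lookup∘tabulate (λ v → positive (arc u v)) v)

      arc⁻ : ∀ u v → Arc D u v → 0 < arc u v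
      arc⁻ u v uv with arc u v | trans (sym (lookup-D u v)) ([]=⇒lookup uv)
      ... | suc _ | _ = s≤s z≤n

      arc⁺ : ∀ u v → 0 < arc u v → Arc D u v
      arc⁺ u v lt = lookup⇒[]= v _ (trans (lookup-D u v) (pos lt))
        where
        pos : ∀ {k} → 0 < k → positive k ≡ true
        pos (s≤s _) = refl

      bit≤1 : ∀ b → bit b ≤ 1
      bit≤1 true  = ℕ.≤-refl
      bit≤1 false = z≤n

      bit-positive : ∀ k → bit (positive k) ≤ k
      bit-positive zero    = z≤n
      bit-positive (suc k) = s≤s z≤n

      isOrientation : IsOrientation G D
      isOrientation = orientation
        (λ u v uv → arc⇒adj u v (arc⁻ u v uv))
        adj⇒arc
        (λ u v uv vu → ℕ.<-irrefl refl (ℕ.≤-trans (ℕ.+-mono-≤ (arc⁻ u v uv) (arc⁻ v u vu))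
          (ℕ.≤-trans (ℕ.≤-reflexive (oriented u v)) (bit≤1 (does (adj? G u v))))))
        where
        arc⇒adj : ∀ u v → 0 < arc u v → Adj G u v
        arc⇒adj u v lt with adj? G u v | oriented u v
        ... | yes uv | _  = uv
        ... | no _   | eq = contradiction (ℕ.m+n≡0⇒m≡0 _ eq) (ℕ.<⇒≢ lt ∘ sym)

        adj⇒arc : ∀ u v → Adj G u v → Arc D u v ⊎ Arc D v u
        adj⇒arc u v uv with arc u v in eq₁ | arc v u in eq₂
                          | trans (oriented u v) (cong bit (dec-true (adj? G u v) uv))
        ... | suc _ | _     | _ = inj₁ (arc⁺ u v (subst (0 <_) (sym eq₁) (s≤s z≤n)))
        ... | zero  | suc _ | _ = inj₂ (arc⁺ v u (subst (0 <_) (sym eq₂) (s≤s z≤n)))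

      EE≢EO : EE D ≢ EO D
      EE≢EO eq = EE≢0 D (trans eq (layered⇒EO≡0 D rank side λ u v uv → layered u v (arc⁻ u v uv)))

      out< : ∀ u → outDegree D u < suc s
      out< u = s≤s (begin
        outDegree D u                     ≡⟨ ∣∣-sum (lookup D u) ⟩
        sum (entry D u)                   ≤⟨ sum-mono (λ v → ℕ.≤-trans
          (ℕ.≤-reflexive (cong bit (lookup-D u v))) (bit-positive (arc u v))) ⟩
        sum (arc u)                       ≤⟨ outs-≤ u ⟩
        s                                 ∎)
        where open ℕ.≤-Reasoning

-- Peeling a graph into layers.

module Peeling where

  open FiniteSums
  open BalancedOrientation using (balancedOrientation)
  open LayeredOrientation
  open import Data.Bool.Base using (Bool; true; false; _∧_; _∨_; not; if_then_else_)
  open import Data.Bool.Properties using () renaming (_≟_ to _≟ᵇ_)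
  open import Data.Fin.Base using (Fin; zero; suc)
  open import Data.Fin.Properties using (any?) renaming (_≟_ to _≟ᶠ_)
  open import Data.List.Base as List using (allFin)
  open import Data.List.Extrema.Nat using (xs≤max)
  open import Data.List.Membership.Propositional.Properties using (∈-map⁺; ∈-allFin)
  import Data.List.Relation.Unary.All as All
  open import Data.Nat.Base using (ℕ; zero; suc; _+_; _*_; _≤_; _<_; z≤n; s≤s)
  import Data.Nat.Properties as ℕ
  open import Data.Nat.Tactic.RingSolver using (solve-∀)
  open import Data.Product.Base using (∃; ∃₂; _×_; _,_; proj₁; proj₂)
  open import Data.Sum.Base using (_⊎_; inj₁; inj₂)
  open import Data.Vec.Properties using (lookup∘tabulate)
  open import Function.Base using (_∘_)
  open import Relation.Binary.PropositionalEquality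
    using (_≡_; _≢_; refl; sym; trans; cong; cong₂; subst₂; module ≡-Reasoning)
  open import Relation.Nullary.Decidable using (yes; no; does; _×-dec_; dec-true; dec-false)
  open import Relation.Nullary.Negation using (¬_; contradiction)

  VertexSet : ℕ → Set
  VertexSet n = Fin n → Bool

  module _ {n : ℕ} where

    _∋_ : VertexSet n → Fin n → Set
    W ∋ u = W u ≡ true

    ⟨_⟩ : VertexSet n → Fin n → ℕ
    ⟨ W ⟩ u = bit (W u)

    card : VertexSet n → ℕ
    card W = sum ⟨ W ⟩

    _∖_ : VertexSet n → VertexSet n → VertexSet n
    (W ∖ S) u = W u ∧ not (S u)

    ∖-+ : ∀ W S → (∀ u → S ∋ u → W ∋ u) → ∀ u → ⟨ W ⟩ u ≡ ⟨ S ⟩ u + ⟨ W ∖ S ⟩ u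
    ∖-+ W S S⊆W u with S u | W u | S⊆W u
    ... | true  | true  | _   = refl
    ... | true  | false | sub = contradiction (sub refl) λ ()
    ... | false | true  | _   = refl
    ... | false | false | _   = refl

    singleton : Fin n → VertexSet n
    singleton u v = does (u ≟ᶠ v)

    ⟨singleton⟩ : ∀ u v → ⟨ singleton u ⟩ v ≡ δ u v
    ⟨singleton⟩ u v with u ≟ᶠ v
    ... | yes _ = refl
    ... | no _  = refl

    singleton-⊆ : ∀ {W u} → W ∋ u → ∀ v → singleton u ∋ v → W ∋ v
    singleton-⊆ {u = u} u∈ v v∈ with u ≟ᶠ v
    ... | yes refl = u∈

    card-∖ : ∀ W S → (∀ u → S ∋ u → W ∋ u) → card W ≡ card S + card (W ∖ S)
    card-∖ W S S⊆W = trans (sum-cong-≗ (∖-+ W S S⊆W)) (∑-distrib-+ ⟨ S ⟩ ⟨ W ∖ S ⟩)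

    member⇒card : ∀ S {u} → S ∋ u → 1 ≤ card S
    member⇒card S {u} u∈ = ℕ.≤-trans (ℕ.≤-reflexive (sym (cong bit u∈))) (term≤sum ⟨ S ⟩ u)

    card-∖-< : ∀ {W S} k → (∀ u → S ∋ u → W ∋ u) → (∃ λ u → S ∋ u) → card W ≤ suc k → card (W ∖ S) ≤ k
    card-∖-< {W} {S} k S⊆W (u , u∈) le = ℕ.+-cancelˡ-≤ 1 _ _ (ℕ.≤-trans
      (ℕ.+-monoˡ-≤ (card (W ∖ S)) (member⇒card S u∈))
      (ℕ.≤-trans (ℕ.≤-reflexive (sym (card-∖ W S S⊆W))) le))

  module _ {n : ℕ} (G : Graph n) where

    private
      A : Fin n → Fin n → ℕ
      A = adjacency G

    adjacency-sym : ∀ u v → A u v ≡ A v u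
    adjacency-sym u v with adj? G u v | adj? G v u
    ... | yes _  | yes _  = refl
    ... | no _   | no _   = refl
    ... | yes uv | no ¬vu = contradiction (symmetric G uv) ¬vu
    ... | no ¬uv | yes vu = contradiction (symmetric G vu) ¬uv

    adjacency-irrefl : ∀ u → A u u ≡ 0
    adjacency-irrefl u = cong bit (dec-false (adj? G u u) (irreflexive G refl))

    deg : (Fin n → ℕ) → Fin n → ℕ
    deg X u = sum λ v → X v * A u v

    deg-cong : ∀ {X Y} → (∀ v → X v ≡ Y v) → ∀ u → deg X u ≡ deg Y u
    deg-cong eq u = sum-cong-≗ λ v → cong (_* A u v) (eq v)

    deg-+ : ∀ X Y u → deg (λ v → X v + Y v) u ≡ deg X u + deg Y u
    deg-+ X Y u = trans (sum-cong-≗ λ v → ℕ.*-distribʳ-+ (A u v) (X v) (Y v))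
                        (∑-distrib-+ (λ v → X v * A u v) _)

    -- The bilinear form of the adjacency matrix. On the indicator of S with itself it is twice the
    -- number of edges inside S.
    pairs : (Fin n → ℕ) → (Fin n → ℕ) → ℕ
    pairs X Y = sum λ u → X u * deg Y u

    pairs-sym : ∀ X Y → pairs X Y ≡ pairs Y X
    pairs-sym X Y = begin
      sum (λ u → X u * deg Y u)                    ≡⟨ sum-cong-≗ (λ u → *-distribˡ-sum (X u) (λ v → Y v * A u v)) ⟩
      sum (λ u → sum λ v → X u * (Y v * A u v))    ≡⟨ ∑-comm (λ u v → X u * (Y v * A u v)) ⟩
      sum (λ v → sum λ u → X u * (Y v * A u v))    ≡⟨ sum-cong-≗ (λ v → sum-cong-≗ λ u →
                                                        trans (cong (λ a → X u * (Y v * a)) (adjacency-sym u v))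
                                                              (arith (X u) (Y v) (A v u))) ⟩
      sum (λ v → sum λ u → Y v * (X u * A v u))    ≡⟨ sum-cong-≗ (λ v → *-distribˡ-sum (Y v) (λ u → X u * A v u)) ⟨
      sum (λ v → Y v * deg X v) ∎
      where
      open ≡-Reasoning
      arith : ∀ x y a → x * (y * a) ≡ y * (x * a)
      arith = solve-∀

    pairs-cong : ∀ {X X′ Y Y′} → (∀ v → X v ≡ X′ v) → (∀ v → Y v ≡ Y′ v) → pairs X Y ≡ pairs X′ Y′
    pairs-cong eq eq′ = sum-cong-≗ λ u → cong₂ _*_ (eq u) (deg-cong eq′ u)

    pairs-+ˡ : ∀ X X′ Y → pairs (λ v → X v + X′ v) Y ≡ pairs X Y + pairs X′ Y
    pairs-+ˡ X X′ Y = trans (sum-cong-≗ λ u → ℕ.*-distribʳ-+ (deg Y u) (X u) (X′ u))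
                            (∑-distrib-+ (λ u → X u * deg Y u) _)

    pairs-+ʳ : ∀ X Y Y′ → pairs X (λ v → Y v + Y′ v) ≡ pairs X Y + pairs X Y′
    pairs-+ʳ X Y Y′ = trans (pairs-sym X (λ v → Y v + Y′ v)) (trans (pairs-+ˡ Y Y′ X)
      (cong₂ _+_ (pairs-sym Y X) (pairs-sym Y′ X)))

    pairs-δ : ∀ u Y → pairs (δ u) Y ≡ deg Y u
    pairs-δ u Y = sum-δ u (deg Y)

    -- The form is expanded along ⟨S⟩ = δ_u + X. The vertex `u` enters once in each argument, at a
    -- cost of at most its degree in S each time.
    pairs-remove : ∀ S u → S ∋ u →
                   pairs ⟨ S ⟩ ⟨ S ⟩ ≤ pairs ⟨ S ∖ singleton u ⟩ ⟨ S ∖ singleton u ⟩ + 2 * deg ⟨ S ⟩ u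
    pairs-remove S u u∈ = begin
      pairs ⟨ S ⟩ ⟨ S ⟩                                        ≡⟨ pairs-cong {⟨ S ⟩} {Z} {⟨ S ⟩} {Z} split split ⟩
      pairs Z Z                                                ≡⟨ pairs-+ˡ (δ u) X Z ⟩
      pairs (δ u) Z + pairs X Z
        ≡⟨ cong₂ _+_ (trans (pairs-δ u Z) (sym (deg-cong {⟨ S ⟩} {Z} split u))) (pairs-+ʳ X (δ u) X) ⟩
      deg ⟨ S ⟩ u + (pairs X (δ u) + pairs X X)
        ≡⟨ cong (λ x → deg ⟨ S ⟩ u + (x + pairs X X)) (trans (pairs-sym X (δ u)) (pairs-δ u X)) ⟩
      deg ⟨ S ⟩ u + (deg X u + pairs X X)
        ≤⟨ ℕ.+-monoʳ-≤ (deg ⟨ S ⟩ u) (ℕ.+-monoˡ-≤ (pairs X X) smaller) ⟩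
      deg ⟨ S ⟩ u + (deg ⟨ S ⟩ u + pairs X X)
        ≡⟨ arith (deg ⟨ S ⟩ u) (pairs X X) ⟩
      pairs X X + 2 * deg ⟨ S ⟩ u ∎
      where
      open ℕ.≤-Reasoning
      X Z : Fin n → ℕ
      X = ⟨ S ∖ singleton u ⟩
      Z v = δ u v + X v

      split : ∀ v → ⟨ S ⟩ v ≡ δ u v + X v
      split v = trans (∖-+ S (singleton u) (singleton-⊆ u∈) v) (cong (_+ X v) (⟨singleton⟩ u v))

      smaller : deg X u ≤ deg ⟨ S ⟩ u
      smaller = sum-mono λ v → ℕ.*-monoˡ-≤ (A u v) (ℕ.≤-trans (ℕ.m≤n+m (X v) (δ u v)) (ℕ.≤-reflexive (sym (split v))))

      arith : ∀ x p → x + (x + p) ≡ p + 2 * x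
      arith = solve-∀

    -- Deleting a vertex of degree at most K preserves the density hypothesis.

    prune : ∀ K k S → card S ≤ k → 2 * K * card S < pairs ⟨ S ⟩ ⟨ S ⟩ →
            ∃ λ S′ → (∀ u → S′ ∋ u → S ∋ u) × (∃ λ u → S′ ∋ u) × (∀ u → S′ ∋ u → K < deg ⟨ S′ ⟩ u)
    prune K k S le dense with any? (λ u → S u ≟ᵇ true)
    ... | no empty = contradiction (ℕ.<-≤-trans dense (ℕ.≤-reflexive pairs≡0)) ℕ.n≮0
      where
      pairs≡0 : pairs ⟨ S ⟩ ⟨ S ⟩ ≡ 0
      pairs≡0 = trans (sum-cong-≗ λ u → outside u) (sum-replicate-zero n)
        where
        outside : ∀ u → ⟨ S ⟩ u * deg ⟨ S ⟩ u ≡ 0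
        outside u with S u in eq
        ... | true  = contradiction (u , eq) empty
        ... | false = refl
    ... | yes nonempty with any? (λ u → (S u ≟ᵇ true) ×-dec (deg ⟨ S ⟩ u ℕ.≤? K))
    ...   | no ¬low = S , (λ _ u∈ → u∈) , nonempty , λ u u∈ → ℕ.≰⇒> λ low → ¬low (u , u∈ , low)
    ...   | yes (u , u∈ , low) with k
    ...     | zero  = contradiction (ℕ.≤-trans (member⇒card S u∈) le) ℕ.n≮0
    ...     | suc k with prune K k (S ∖ singleton u)
                          (card-∖-< k (singleton-⊆ u∈) (u , dec-true (u ≟ᶠ u) refl) le) dense′
      where
      S⁻ = S ∖ singleton u

      card-S : card S ≡ suc (card S⁻)
      card-S = trans (card-∖ S (singleton u) (singleton-⊆ u∈)) (cong (_+ card S⁻)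
        (trans (sum-cong-≗ (λ v → trans (⟨singleton⟩ u v) (sym (ℕ.*-identityʳ (δ u v))))) (sum-δ u (λ _ → 1))))

      dense′ : 2 * K * card S⁻ < pairs ⟨ S⁻ ⟩ ⟨ S⁻ ⟩
      -- Removing `u` lowers the left side by exactly 2K and the right side by at most 2K.
      dense′ = ℕ.+-cancelʳ-< (2 * K) _ _ (begin-strict
        2 * K * card S⁻ + 2 * K             ≡⟨ arith (2 * K) (card S⁻) ⟩
        2 * K * suc (card S⁻)               ≡⟨ cong (2 * K *_) card-S ⟨
        2 * K * card S                      <⟨ dense ⟩
        pairs ⟨ S ⟩ ⟨ S ⟩                   ≤⟨ pairs-remove S u u∈ ⟩
        pairs ⟨ S⁻ ⟩ ⟨ S⁻ ⟩ + 2 * deg ⟨ S ⟩ u ≤⟨ ℕ.+-monoʳ-≤ (pairs ⟨ S⁻ ⟩ ⟨ S⁻ ⟩) (ℕ.*-monoʳ-≤ 2 low) ⟩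
        pairs ⟨ S⁻ ⟩ ⟨ S⁻ ⟩ + 2 * K         ∎)
        where
        open ℕ.≤-Reasoning
        arith : ∀ x y → x * y + x ≡ x * suc y
        arith = solve-∀
    ...       | S′ , S′⊆ , nonempty′ , min = S′ , (λ v v∈ → ∖-⊆ v (S′⊆ v v∈)) , nonempty′ , min
      where
      ∖-⊆ : ∀ v → (S ∖ singleton u) ∋ v → S ∋ v
      ∖-⊆ v eq with S v
      ... | true = refl

    does-≡ : ∀ {k} (x y : Fin k) → does (x ≟ᶠ y) ≡ true → x ≡ y
    does-≡ x y eq with x ≟ᶠ y
    ... | yes x≡y = x≡y

    -- Averaging over pairs of colour classes.

    module Classes {k : ℕ} (c : Fin n → Fin k) (proper : Proper G c) (W : VertexSet n) where

      class : Fin k → Fin n → ℕ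
      class i u = δ (c u) i * ⟨ W ⟩ u

      classes-sum : ∀ u → sum (λ i → class i u) ≡ ⟨ W ⟩ u
      classes-sum u = sum-δ (c u) (λ _ → ⟨ W ⟩ u)

      -- The classes add up to ⟨W⟩, and the form is linear in each argument.
      pairs-classes : sum (λ i → sum λ j → pairs (class i) (class j)) ≡ pairs ⟨ W ⟩ ⟨ W ⟩
      pairs-classes = begin
        sum (λ i → sum λ j → pairs (class i) (class j))
          ≡⟨ sum-cong-≗ (λ i → pairs-sumʳ (class i)) ⟩
        sum (λ i → pairs (class i) ⟨ W ⟩)
          ≡⟨ sum-cong-≗ (λ i → pairs-sym (class i) ⟨ W ⟩) ⟩
        sum (λ i → pairs ⟨ W ⟩ (class i))
          ≡⟨ pairs-sumʳ ⟨ W ⟩ ⟩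
        pairs ⟨ W ⟩ ⟨ W ⟩ ∎
        where
        open ≡-Reasoning
        pairs-sumʳ : ∀ X → sum (λ j → pairs X (class j)) ≡ pairs X ⟨ W ⟩
        pairs-sumʳ X = begin
          sum (λ j → sum λ u → X u * deg (class j) u)
            ≡⟨ ∑-comm (λ j u → X u * deg (class j) u) ⟩
          sum (λ u → sum λ j → X u * deg (class j) u)
            ≡⟨ sum-cong-≗ (λ u → sym (*-distribˡ-sum (X u) (λ j → deg (class j) u))) ⟩
          sum (λ u → X u * sum (λ j → sum λ v → class j v * A u v))
            ≡⟨ sum-cong-≗ (λ u → cong (X u *_) (∑-comm (λ j v → class j v * A u v))) ⟩
          sum (λ u → X u * sum (λ v → sum λ j → class j v * A u v))
            ≡⟨ sum-cong-≗ (λ u → cong (X u *_) (sum-cong-≗ λ v → trans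
                 (sym (*-distribʳ-sum (A u v) (λ j → class j v))) (cong (_* A u v) (classes-sum v)))) ⟩
          sum (λ u → X u * deg ⟨ W ⟩ u) ∎

      -- Among the ordered pairs of colours, each class occurs k times as the first and k times as
      -- the second, whence the factor 2k.
      cards-classes : ∀ K → sum (λ i → sum λ j → K * (sum (class i) + sum (class j))) ≡ 2 * k * K * card W
      cards-classes K = begin
        sum (λ i → sum λ j → K * (sum (class i) + sum (class j)))
          ≡⟨ sum-cong-≗ (λ i → trans (sym (*-distribˡ-sum K (λ j → sum (class i) + sum (class j))))
               (cong (K *_) (trans (∑-distrib-+ (λ _ → sum (class i)) (λ j → sum (class j)))
                 (cong₂ _+_ (sum-const k (sum (class i))) total-W)))) ⟩
        sum (λ i → K * (k * sum (class i) + card W))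
          ≡⟨ *-distribˡ-sum K (λ i → k * sum (class i) + card W) ⟨
        K * sum (λ i → k * sum (class i) + card W)
          ≡⟨ cong (K *_) (trans (∑-distrib-+ (λ i → k * sum (class i)) (λ _ → card W))
               (cong₂ _+_ (trans (sym (*-distribˡ-sum k (λ i → sum (class i)))) (cong (k *_) total-W))
                          (sum-const k (card W)))) ⟩
        K * (k * card W + k * card W)
          ≡⟨ arith K k (card W) ⟩
        2 * k * K * card W ∎
        where
        open ≡-Reasoning
        arith : ∀ K k w → K * (k * w + k * w) ≡ 2 * k * K * w
        arith = solve-∀

        sum-const : ∀ k x → sum {k} (λ _ → x) ≡ k * x
        sum-const zero    x = refl
        sum-const (suc k) x = cong (x +_) (sum-const k x)

        total-W : sum (λ j → sum (class j)) ≡ card W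
        total-W = trans (∑-comm class) (sum-cong-≗ classes-sum)

      DensePair : ℕ → Fin k → Fin k → Set
      DensePair K i j = K * (sum (class i) + sum (class j)) < pairs (class i) (class j)

      -- If no pair were dense, adding the opposite inequalities over all ordered pairs of colours
      -- would contradict the density of W.
      densePair : ∀ K → 2 * k * K * card W < pairs ⟨ W ⟩ ⟨ W ⟩ → ∃₂ (DensePair K)
      densePair K dense
        with any? (λ i → any? λ j → K * (sum (class i) + sum (class j)) ℕ.<? pairs (class i) (class j))
      ... | yes (i , j , ij) = i , j , ij
      ... | no none = contradiction dense (ℕ.≤⇒≯ (begin
        pairs ⟨ W ⟩ ⟨ W ⟩                                          ≡⟨ pairs-classes ⟨
        sum (λ i → sum λ j → pairs (class i) (class j))
          ≤⟨ sum-mono (λ i → sum-mono λ j → ℕ.≮⇒≥ λ lt → none (i , j , lt)) ⟩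
        sum (λ i → sum λ j → K * (sum (class i) + sum (class j)))  ≡⟨ cards-classes K ⟩
        2 * k * K * card W                                         ∎))
        where open ℕ.≤-Reasoning

      union : Fin k → Fin k → VertexSet n
      union i j u = W u ∧ (does (c u ≟ᶠ i) ∨ does (c u ≟ᶠ j))

      class-bit : ∀ i u → class i u ≡ bit (does (c u ≟ᶠ i)) * ⟨ W ⟩ u
      class-bit i u with c u ≟ᶠ i
      ... | yes _ = refl
      ... | no _  = refl

      card-union : ∀ i j → card (union i j) ≤ sum (class i) + sum (class j)
      card-union i j = ℕ.≤-trans
        (sum-mono λ u → subst₂ (λ x y → ⟨ union i j ⟩ u ≤ x + y) (sym (class-bit i u)) (sym (class-bit j u))
          (bits (W u) (does (c u ≟ᶠ i)) (does (c u ≟ᶠ j))))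
        (ℕ.≤-reflexive (∑-distrib-+ (class i) (class j)))
        where
        bits : ∀ w p q → bit (w ∧ (p ∨ q)) ≤ bit p * bit w + bit q * bit w
        bits false p     q     = z≤n
        bits true  true  q     = s≤s z≤n
        bits true  false true  = s≤s z≤n
        bits true  false false = z≤n

      -- Each edge between the two classes is counted in both directions inside their union.
      pairs-union : ∀ i j → 2 * pairs (class i) (class j) ≤ pairs ⟨ union i j ⟩ ⟨ union i j ⟩
      pairs-union i j = begin
        2 * pairs (class i) (class j)
          ≡⟨ cong (pairs (class i) (class j) +_) (ℕ.+-identityʳ _) ⟩
        pairs (class i) (class j) + pairs (class i) (class j)
          ≡⟨ cong (pairs (class i) (class j) +_) (pairs-sym (class i) (class j)) ⟩
        pairs (class i) (class j) + pairs (class j) (class i)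
          ≡⟨ ∑-distrib-+ (λ u → class i u * deg (class j) u) _ ⟨
        sum (λ u → class i u * deg (class j) u + class j u * deg (class i) u)
          ≡⟨ sum-cong-≗ (λ u → cong₂ _+_ (*-distribˡ-sum (class i u) (λ v → class j v * A u v))
                                         (*-distribˡ-sum (class j u) (λ v → class i v * A u v))) ⟩
        sum (λ u → sum (λ v → class i u * (class j v * A u v)) + sum (λ v → class j u * (class i v * A u v)))
          ≡⟨ sum-cong-≗ (λ u → ∑-distrib-+ (λ v → class i u * (class j v * A u v)) _) ⟨
        sum (λ u → sum λ v → class i u * (class j v * A u v) + class j u * (class i v * A u v))
          ≤⟨ sum-mono (λ u → sum-mono λ v → entrywise u v) ⟩
        sum (λ u → sum λ v → ⟨ union i j ⟩ u * (⟨ union i j ⟩ v * A u v))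
          ≡⟨ sum-cong-≗ (λ u → *-distribˡ-sum (⟨ union i j ⟩ u) (λ v → ⟨ union i j ⟩ v * A u v)) ⟨
        pairs ⟨ union i j ⟩ ⟨ union i j ⟩ ∎
        where
        open ℕ.≤-Reasoning
        bits : ∀ p q p′ q′ → ¬ (p ≡ true × q ≡ true × p′ ≡ true × q′ ≡ true) →
               bit p * bit q′ + bit q * bit p′ ≤ bit (p ∨ q) * bit (p′ ∨ q′)
        bits true  true  true  true  ne = contradiction (refl , refl , refl , refl) ne
        bits true  true  true  false ne = s≤s z≤n
        bits true  true  false true  ne = s≤s z≤n
        bits true  true  false false ne = z≤n
        bits true  false true  true  ne = s≤s z≤n
        bits true  false true  false ne = z≤n
        bits true  false false true  ne = s≤s z≤n
        bits true  false false false ne = z≤n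
        bits false true  true  q′    ne = s≤s z≤n
        bits false true  false q′    ne = z≤n
        bits false false p′    q′    ne = z≤n

        bit-∧ : ∀ b b′ → bit (b ∧ b′) ≡ bit b * bit b′
        bit-∧ true  b′ = sym (ℕ.+-identityʳ (bit b′))
        bit-∧ false b′ = refl

        entrywise : ∀ u v → class i u * (class j v * A u v) + class j u * (class i v * A u v) ≤
                    ⟨ union i j ⟩ u * (⟨ union i j ⟩ v * A u v)
        entrywise u v with adj? G u v
        ... | no _   = ℕ.≤-trans (ℕ.≤-reflexive (arith (class i u) (class j v) (class j u) (class i v))) z≤n
          where
          arith : ∀ x y z t → x * (y * 0) + z * (t * 0) ≡ 0
          arith = solve-∀
        ... | yes uv rewrite class-bit i u | class-bit j u | class-bit i v | class-bit j v
                           | bit-∧ (W u) (does (c u ≟ᶠ i) ∨ does (c u ≟ᶠ j))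
                           | bit-∧ (W v) (does (c v ≟ᶠ i) ∨ does (c v ≟ᶠ j)) = subst₂ _≤_
          (arith₁ (bit (W u)) (bit (W v)) (bit p) (bit q) (bit p′) (bit q′))
          (arith₂ (bit (W u)) (bit (W v)) (bit (p ∨ q)) (bit (p′ ∨ q′)))
          (ℕ.*-monoʳ-≤ (bit (W u) * bit (W v)) (bits p q p′ q′ separated))
          where
          p  = does (c u ≟ᶠ i)
          q  = does (c u ≟ᶠ j)
          p′ = does (c v ≟ᶠ i)
          q′ = does (c v ≟ᶠ j)

          -- The entrywise bound fails only if both vertices lie in both classes. Then i = j, and
          -- two adjacent vertices share a colour.
          separated : ¬ (p ≡ true × q ≡ true × p′ ≡ true × q′ ≡ true)
          separated (pt , _ , p′t , _) = proper u v uv (trans (does-≡ (c u) i pt) (sym (does-≡ (c v) i p′t)))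

          arith₁ : ∀ w w′ p q p′ q′ → w * w′ * (p * q′ + q * p′) ≡
                   p * w * (q′ * w′ * 1) + q * w * (p′ * w′ * 1)
          arith₁ = solve-∀

          arith₂ : ∀ w w′ x y → w * w′ * (x * y) ≡ w * x * (w′ * y * 1)
          arith₂ = solve-∀

      union-⊆ : ∀ i j u → union i j ∋ u → W ∋ u
      union-⊆ i j u eq with W u
      ... | true = refl

      -- Two vertices of the union on the same side share a colour: `i` if both tests succeed and
      -- `j` if both fail.
      union-sides : ∀ i j u v → union i j ∋ u → union i j ∋ v → Adj G u v →
                    does (c u ≟ᶠ i) ≢ does (c v ≟ᶠ i)
      union-sides i j u v u∈ v∈ uv eq with W u | W v | c u ≟ᶠ i | c v ≟ᶠ i | c u ≟ᶠ j | c v ≟ᶠ j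
      ... | true | true | yes p | yes q | _     | _     = proper u v uv (trans p (sym q))
      ... | true | true | no _  | no _  | yes p | yes q = proper u v uv (trans p (sym q))

    -- The two kinds of layers and their assembly.

    -- A layer S of the remaining graph W.  Its arcs to W ∖ S will all point
    -- away from S.

    record Layer (s : ℕ) (W : VertexSet n) : Set where
      field
        S        : VertexSet n
        S⊆W      : ∀ u → S ∋ u → W ∋ u
        nonempty : ∃ λ u → S ∋ u
        arc      : Fin n → Fin n → ℕ
        oriented : ∀ u v → arc u v + arc v u ≡ ⟨ S ⟩ u * (⟨ S ⟩ v * A u v)
        side     : Fin n → Bool
        layered  : ∀ u v → 0 < arc u v → side u ≢ side v
        outs-≤   : ∀ u → S ∋ u → sum (arc u) + deg ⟨ W ∖ S ⟩ u ≤ s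

    lowLayer : ∀ s W u → W ∋ u → deg ⟨ W ⟩ u ≤ s → Layer s W
    lowLayer s W u u∈ low = record
      { S        = singleton u
      ; S⊆W      = singleton-⊆ u∈
      ; nonempty = u , dec-true (u ≟ᶠ u) refl
      ; arc      = λ _ _ → 0
      ; oriented = no-arcs
      ; side     = λ _ → true
      ; layered  = λ _ _ ()
      ; outs-≤   = outs
      }
      where
      no-arcs : ∀ x y → 0 ≡ ⟨ singleton u ⟩ x * (⟨ singleton u ⟩ y * A x y)
      no-arcs x y with u ≟ᶠ x | u ≟ᶠ y
      ... | no _     | _        = refl
      ... | yes _    | no _     = refl
      ... | yes refl | yes refl rewrite adjacency-irrefl u = refl

      outs : ∀ v → singleton u ∋ v → sum {n} (λ _ → 0) + deg ⟨ W ∖ singleton u ⟩ v ≤ s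
      outs v v∈ with u ≟ᶠ v
      ... | yes refl rewrite sum-replicate-zero n = ℕ.≤-trans
        (sum-mono λ x → ℕ.*-monoˡ-≤ (A u x) (ℕ.≤-trans (ℕ.m≤n+m _ (⟨ singleton u ⟩ x))
          (ℕ.≤-reflexive (sym (∖-+ W (singleton u) (singleton-⊆ u∈) x)))))
        low

    -- Of the at most s + m edges of W at a vertex of S, at least m come in under a balanced
    -- orientation of the edges inside S, which leaves at most s going out.
    bipartiteLayer : ∀ s m W → (∀ u → deg ⟨ W ⟩ u ≤ s + m) →
                     ∀ S → (∀ u → S ∋ u → W ∋ u) → (∃ λ u → S ∋ u) →
                     (side : Fin n → Bool) → (∀ u v → S ∋ u → S ∋ v → Adj G u v → side u ≢ side v) →
                     (∀ u → S ∋ u → 2 * m < deg ⟨ S ⟩ u) → Layer s W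
    bipartiteLayer s m W deg≤ S S⊆W nonempty side bichromatic dense = record
      { S        = S
      ; S⊆W      = S⊆W
      ; nonempty = nonempty
      ; arc      = a
      ; oriented = oriented
      ; side     = side
      ; layered  = layered
      ; outs-≤   = outs
      }
      where
      M : Fin n → Fin n → ℕ
      -- Each edge inside S is entered once, in the row of its end on the `true` side.
      M u v = ⟨ S ⟩ u * (⟨ S ⟩ v * A u v) * bit (side u)

      balanced = balancedOrientation M
      a = proj₁ balanced

      one-side : ∀ u v → M u v + M v u ≡ ⟨ S ⟩ u * (⟨ S ⟩ v * A u v)
      one-side u v rewrite adjacency-sym v u with S u in equ | S v in eqv | adj? G u v
      ... | false | false | _      = refl
      ... | false | true  | _      = refl
      ... | true  | false | _      = refl
      ... | true  | true  | no _   = refl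
      ... | true  | true  | yes uv with side u | side v | bichromatic u v equ eqv uv
      ...   | true  | true  | ne = contradiction refl ne
      ...   | true  | false | ne = refl
      ...   | false | true  | ne = refl
      ...   | false | false | ne = contradiction refl ne

      oriented : ∀ u v → a u v + a v u ≡ ⟨ S ⟩ u * (⟨ S ⟩ v * A u v)
      oriented u v = trans (proj₁ (proj₂ balanced) u v) (one-side u v)

      layered : ∀ u v → 0 < a u v → side u ≢ side v
      layered u v lt with S u in equ | S v in eqv | adj? G u v | oriented u v
      ... | true  | true  | yes uv | _  = bichromatic u v equ eqv uv
      ... | true  | true  | no _   | eq = contradiction (ℕ.m+n≡0⇒m≡0 (a u v) eq) (ℕ.<⇒≢ lt ∘ sym)
      ... | true  | false | _      | eq = contradiction (ℕ.m+n≡0⇒m≡0 (a u v) eq) (ℕ.<⇒≢ lt ∘ sym)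
      ... | false | _     | _      | eq = contradiction (ℕ.m+n≡0⇒m≡0 (a u v) eq) (ℕ.<⇒≢ lt ∘ sym)

      outs : ∀ u → S ∋ u → sum (a u) + deg ⟨ W ∖ S ⟩ u ≤ s
      outs u u∈ = ℕ.+-cancelʳ-≤ m _ _ (begin
        out + rest + m         ≤⟨ ℕ.+-monoʳ-≤ (out + rest) m≤in ⟩
        out + rest + inn       ≡⟨ arith out rest inn ⟩
        out + inn + rest       ≡⟨ cong (_+ rest) degree-S ⟩
        deg ⟨ S ⟩ u + rest     ≡⟨ deg-+ ⟨ S ⟩ ⟨ W ∖ S ⟩ u ⟨
        deg (λ v → ⟨ S ⟩ v + ⟨ W ∖ S ⟩ v) u ≡⟨ deg-cong (∖-+ W S S⊆W) u ⟨
        deg ⟨ W ⟩ u            ≤⟨ deg≤ u ⟩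
        s + m                  ∎)
        where
        open ℕ.≤-Reasoning
        out  = sum (a u)
        inn  = sum (λ v → a v u)
        rest = deg ⟨ W ∖ S ⟩ u

        arith : ∀ o r i → o + r + i ≡ o + i + r
        arith = solve-∀

        degree-S : out + inn ≡ deg ⟨ S ⟩ u
        degree-S = trans (sym (∑-distrib-+ (a u) (λ v → a v u))) (sum-cong-≗ λ v → trans (oriented u v)
          (trans (cong (λ b → bit b * (⟨ S ⟩ v * A u v)) u∈) (ℕ.*-identityˡ _)))

        m≤in : m ≤ inn
        -- The strict bound on the degree in S absorbs the one unit by which the out-degree may
        -- exceed the in-degree.
        m≤in = ℕ.*-cancelˡ-≤ 2 (ℕ.+-cancelˡ-≤ 1 _ _ (begin
          1 + 2 * m          ≤⟨ dense u u∈ ⟩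
          deg ⟨ S ⟩ u        ≡⟨ degree-S ⟨
          out + inn          ≤⟨ ℕ.+-monoˡ-≤ inn (proj₂ (proj₂ balanced) u) ⟩
          suc inn + inn      ≡⟨ cong (λ x → suc (inn + x)) (ℕ.+-identityʳ inn) ⟨
          1 + 2 * inn        ∎))

    -- The number `bound` lies above all ranks in use, so that it can serve as the rank of the next
    -- layer added on top.
    record PartialOrientation (s : ℕ) (W : VertexSet n) : Set where
      field
        arc      : Fin n → Fin n → ℕ
        oriented : ∀ u v → arc u v + arc v u ≡ ⟨ W ⟩ u * (⟨ W ⟩ v * A u v)
        bound    : ℕ
        rank     : Fin n → ℕ
        rank<    : ∀ u → rank u < bound
        side     : Fin n → Bool
        layered  : ∀ u v → 0 < arc u v → rank v < rank u ⊎ (rank u ≡ rank v × side u ≢ side v)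
        outs-≤   : ∀ u → sum (arc u) ≤ s

    supported : ∀ {W} {arc : Fin n → Fin n → ℕ} →
                (∀ u v → arc u v + arc v u ≡ ⟨ W ⟩ u * (⟨ W ⟩ v * A u v)) →
                ∀ u v → 0 < arc u v → W ∋ u × W ∋ v
    supported {W} {arc} oriented u v lt with W u | W v | oriented u v
    ... | true  | true  | _  = refl , refl
    ... | true  | false | eq = contradiction (ℕ.m+n≡0⇒m≡0 (arc u v) eq) (ℕ.<⇒≢ lt ∘ sym)
    ... | false | _     | eq = contradiction (ℕ.m+n≡0⇒m≡0 (arc u v) eq) (ℕ.<⇒≢ lt ∘ sym)

    no-outs : ∀ {W} {arc : Fin n → Fin n → ℕ} →
              (∀ u v → arc u v + arc v u ≡ ⟨ W ⟩ u * (⟨ W ⟩ v * A u v)) →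
              ∀ u → W u ≡ false → sum (arc u) ≡ 0
    no-outs {W} {arc} oriented u u∉ = trans (sum-cong-≗ λ v → ℕ.m+n≡0⇒m≡0 (arc u v)
      (trans (oriented u v) (cong (λ b → bit b * (⟨ W ⟩ v * A u v)) u∉))) (sum-replicate-zero n)

    0<-split : ∀ a b c → 0 < a + b + c → 0 < a ⊎ 0 < b ⊎ 0 < c
    0<-split (suc a) b       c lt = inj₁ (s≤s z≤n)
    0<-split zero    (suc b) c lt = inj₂ (inj₁ (s≤s z≤n))
    0<-split zero    zero    c lt = inj₂ (inj₂ lt)

    -- Arcs from S to the rest fall in rank, those inside S stay at the new rank and change sides,
    -- and the others keep their old ranks and sides.
    addLayer : ∀ {s W} (L : Layer s W) → PartialOrientation s (W ∖ Layer.S L) → PartialOrientation s W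
    addLayer {s} {W} L P = record
      { arc      = arc
      ; oriented = oriented
      ; bound    = suc P.bound
      ; rank     = rank
      ; rank<    = rank<
      ; side     = side
      ; layered  = layered
      ; outs-≤   = outs
      }
      where
      module P = PartialOrientation P
      module L = Layer L
      S R : VertexSet n
      S = L.S
      R = W ∖ S

      down : Fin n → Fin n → ℕ
      down u v = ⟨ S ⟩ u * (⟨ R ⟩ v * A u v)

      arc : Fin n → Fin n → ℕ
      arc u v = L.arc u v + P.arc u v + down u v

      rank : Fin n → ℕ
      rank u = if S u then P.bound else P.rank u

      side : Fin n → Bool
      side u = if S u then L.side u else P.side u

      rank< : ∀ u → rank u < suc P.bound
      rank< u with S u
      ... | true  = ℕ.≤-refl
      ... | false = ℕ.m<n⇒m<1+n (P.rank< u)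

      R⇒∉S : ∀ u → R ∋ u → S u ≡ false
      R⇒∉S u eq with W u | S u
      ... | true | false = refl

      S⇒∉R : ∀ u → S ∋ u → R u ≡ false
      S⇒∉R u eq with W u | S u
      ... | true  | true = refl
      ... | false | true = refl

      oriented : ∀ u v → arc u v + arc v u ≡ ⟨ W ⟩ u * (⟨ W ⟩ v * A u v)
      oriented u v = begin
        (L.arc u v + P.arc u v + down u v) + (L.arc v u + P.arc v u + down v u)
          ≡⟨ arith₁ (L.arc u v) (P.arc u v) (down u v) (L.arc v u) (P.arc v u) (down v u) ⟩
        (L.arc u v + L.arc v u) + (P.arc u v + P.arc v u) + (down u v + down v u)
          ≡⟨ cong₂ (λ x y → x + y + (down u v + down v u)) (L.oriented u v) (P.oriented u v) ⟩
        ⟨ S ⟩ u * (⟨ S ⟩ v * A u v) + ⟨ R ⟩ u * (⟨ R ⟩ v * A u v) + (down u v + ⟨ S ⟩ v * (⟨ R ⟩ u * A v u))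
          ≡⟨ cong (λ a → ⟨ S ⟩ u * (⟨ S ⟩ v * A u v) + ⟨ R ⟩ u * (⟨ R ⟩ v * A u v) +
                         (down u v + ⟨ S ⟩ v * (⟨ R ⟩ u * a)))
               (adjacency-sym v u) ⟩
        ⟨ S ⟩ u * (⟨ S ⟩ v * A u v) + ⟨ R ⟩ u * (⟨ R ⟩ v * A u v) + (down u v + ⟨ S ⟩ v * (⟨ R ⟩ u * A u v))
          ≡⟨ arith₂ (⟨ S ⟩ u) (⟨ S ⟩ v) (⟨ R ⟩ u) (⟨ R ⟩ v) (A u v) ⟩
        (⟨ S ⟩ u + ⟨ R ⟩ u) * ((⟨ S ⟩ v + ⟨ R ⟩ v) * A u v)
          ≡⟨ cong₂ (λ x y → x * (y * A u v)) (∖-+ W S L.S⊆W u) (∖-+ W S L.S⊆W v) ⟨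
        ⟨ W ⟩ u * (⟨ W ⟩ v * A u v) ∎
        where
        open ≡-Reasoning
        arith₁ : ∀ a b c a′ b′ c′ → (a + b + c) + (a′ + b′ + c′) ≡ (a + a′) + (b + b′) + (c + c′)
        arith₁ = solve-∀

        arith₂ : ∀ s s′ r r′ a → s * (s′ * a) + r * (r′ * a) + (s * (r′ * a) + s′ * (r * a)) ≡
                 (s + r) * ((s′ + r′) * a)
        arith₂ = solve-∀

      down-support : ∀ u v → 0 < down u v → S ∋ u × R ∋ v
      down-support u v lt with S u | R v | lt
      ... | true | true | _ = refl , refl

      layered : ∀ u v → 0 < arc u v → rank v < rank u ⊎ (rank u ≡ rank v × side u ≢ side v)
      layered u v lt with 0<-split (L.arc u v) (P.arc u v) (down u v) lt
      ... | inj₁ lt₁ with supported {S} {L.arc} L.oriented u v lt₁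
      ...   | u∈ , v∈ rewrite u∈ | v∈ = inj₂ (refl , L.layered u v lt₁)
      layered u v lt | inj₂ (inj₁ lt₂) with supported {R} {P.arc} P.oriented u v lt₂
      ...   | u∈ , v∈ rewrite R⇒∉S u u∈ | R⇒∉S v v∈ = P.layered u v lt₂
      layered u v lt | inj₂ (inj₂ lt₃) with down-support u v lt₃
      ...   | u∈ , v∈ rewrite u∈ | R⇒∉S v v∈ = inj₁ (P.rank< v)

      outs : ∀ u → sum (arc u) ≤ s
      outs u = ℕ.≤-trans (ℕ.≤-reflexive (begin
        sum (λ v → L.arc u v + P.arc u v + down u v)
          ≡⟨ ∑-distrib-+ (λ v → L.arc u v + P.arc u v) (down u) ⟩
        sum (λ v → L.arc u v + P.arc u v) + sum (down u)
          ≡⟨ cong₂ _+_ (∑-distrib-+ (L.arc u) (P.arc u)) (sym (*-distribˡ-sum (⟨ S ⟩ u) (λ v → ⟨ R ⟩ v * A u v))) ⟩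
        sum (L.arc u) + sum (P.arc u) + ⟨ S ⟩ u * deg ⟨ R ⟩ u ∎)) split
        where
        open ≡-Reasoning
        split : sum (L.arc u) + sum (P.arc u) + ⟨ S ⟩ u * deg ⟨ R ⟩ u ≤ s
        -- On S the old orientation has no outgoing arcs; off S neither the layer nor `down` has
        -- any.
        split with S u in eq
        ... | true  rewrite no-outs {R} {P.arc} P.oriented u (S⇒∉R u eq)
                          | ℕ.+-identityʳ (sum (L.arc u)) | ℕ.+-identityʳ (deg ⟨ R ⟩ u) = L.outs-≤ u eq
        ... | false rewrite no-outs {S} {L.arc} L.oriented u eq | ℕ.+-identityʳ (sum (P.arc u)) = P.outs-≤ u

    -- The recursion is on a bound `k` for the number of remaining vertices, which drops because
    -- layers are nonempty.
    peel : ∀ s → (∀ W → (∃ λ u → W ∋ u) → Layer s W) → ∀ k W → card W ≤ k → PartialOrientation s W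
    peel s layer k W le with any? (λ u → W u ≟ᵇ true)
    ... | no empty = record
      { arc      = λ _ _ → 0
      ; oriented = λ u v → sym (cong (_* (⟨ W ⟩ v * A u v)) (outside u))
      ; bound    = 1
      ; rank     = λ _ → 0
      ; rank<    = λ _ → s≤s z≤n
      ; side     = λ _ → true
      ; layered  = λ _ _ ()
      ; outs-≤   = λ _ → ℕ.≤-trans (ℕ.≤-reflexive (sum-replicate-zero n)) z≤n
      }
      where
      outside : ∀ u → ⟨ W ⟩ u ≡ 0
      outside u with W u in eq
      ... | true  = contradiction (u , eq) empty
      ... | false = refl
    peel s layer zero    W le | yes (u , u∈) = contradiction (ℕ.≤-trans (member⇒card W u∈) le) ℕ.n≮0
    peel s layer (suc k) W le | yes nonempty = addLayer L
      (peel s layer k (W ∖ S) (card-∖-< {W = W} {S} k S⊆W ne le))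
      where
      L = layer W nonempty
      open Layer L using (S; S⊆W) renaming (nonempty to ne)

    -- Here `m` bounds the excess of the degrees over `s`. Averaging is applied with K = 2m, the
    -- degree that `bipartiteLayer` wants exceeded. With k colours this takes density 2k · 2m,
    -- whence the hypothesis on 4km.
    findLayer : ∀ {k} s m → Colourable G k → 4 * k * m ≤ s → (∀ W u → deg ⟨ W ⟩ u ≤ s + m) →
                ∀ W → (∃ λ u → W ∋ u) → Layer s W
    findLayer {k} s m (c , proper) km≤s deg≤ W (w , w∈)
      with any? (λ u → (W u ≟ᵇ true) ×-dec (deg ⟨ W ⟩ u ℕ.≤? s))
    ... | yes (u , u∈ , low) = lowLayer s W u u∈ low
    ... | no none with Classes.densePair c proper W (2 * m) dense
      where
      dense : 2 * k * (2 * m) * card W < pairs ⟨ W ⟩ ⟨ W ⟩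
      dense = begin-strict
        2 * k * (2 * m) * card W             ≡⟨ cong (_* card W) (arith k m) ⟩
        4 * k * m * card W                   ≤⟨ ℕ.*-monoˡ-≤ (card W) km≤s ⟩
        s * card W                           <⟨ ℕ.m<n+m (s * card W) (member⇒card W w∈) ⟩
        suc s * card W                       ≡⟨ *-distribˡ-sum (suc s) ⟨ W ⟩ ⟩
        sum (λ u → suc s * ⟨ W ⟩ u)          ≤⟨ sum-mono degrees ⟩
        pairs ⟨ W ⟩ ⟨ W ⟩                    ∎
        where
        open ℕ.≤-Reasoning
        arith : ∀ k m → 2 * k * (2 * m) ≡ 4 * k * m
        arith = solve-∀

        degrees : ∀ u → suc s * ⟨ W ⟩ u ≤ ⟨ W ⟩ u * deg ⟨ W ⟩ u
        degrees u with W u in eq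
        ... | true  = subst₂ _≤_ (sym (ℕ.*-identityʳ (suc s))) (sym (ℕ.*-identityˡ (deg ⟨ W ⟩ u)))
                        (ℕ.≰⇒> λ low → none (u , eq , low))
        ... | false = ℕ.≤-reflexive (ℕ.*-zeroʳ (suc s))
    ...   | i , j , ij with prune (2 * m) _ (Classes.union c proper W i j) ℕ.≤-refl dense-union
      where
      open Classes c proper W
      -- Counting the edges of the union in both directions supplies the factor 2 in the density
      -- that `prune` expects.
      dense-union : 2 * (2 * m) * card (union i j) < pairs ⟨ union i j ⟩ ⟨ union i j ⟩
      dense-union = begin-strict
        2 * (2 * m) * card (union i j)       ≡⟨ ℕ.*-assoc 2 (2 * m) _ ⟩
        2 * (2 * m * card (union i j))       ≤⟨ ℕ.*-monoʳ-≤ 2 (ℕ.*-monoʳ-≤ (2 * m) (card-union i j)) ⟩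
        2 * (2 * m * (sum (class i) + sum (class j))) <⟨ ℕ.*-monoʳ-< 2 ij ⟩
        2 * pairs (class i) (class j)        ≤⟨ pairs-union i j ⟩
        pairs ⟨ union i j ⟩ ⟨ union i j ⟩    ∎
        where open ℕ.≤-Reasoning
    ...     | S , S⊆ , nonempty , min = bipartiteLayer s m W (deg≤ W) S
        (λ u u∈ → union-⊆ i j u (S⊆ u u∈)) nonempty (λ u → does (c u ≟ᶠ i))
        (λ u v u∈ v∈ → union-sides i j u v (S⊆ u u∈) (S⊆ v v∈)) min
        where open Classes c proper W

    deg-≤-degree : ∀ W u → deg ⟨ W ⟩ u ≤ degree G u
    deg-≤-degree W u = ℕ.≤-trans
      (sum-mono λ v → bits (W v) (A u v))
      (ℕ.≤-reflexive (sym (trans (∣∣-sum (neighbours G u))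
        (sum-cong-≗ λ v → cong bit (lookup∘tabulate (λ v → does (adj? G u v)) v)))))
      where
      bits : ∀ b x → bit b * x ≤ x
      bits true  x = ℕ.≤-reflexive (ℕ.*-identityˡ x)
      bits false x = z≤n

    degree-≤-maxDegree : ∀ u → degree G u ≤ maxDegree G
    degree-≤-maxDegree u = All.lookup (xs≤max 0 (List.map (degree G) (allFin n)))
      (∈-map⁺ (degree G) (∈-allFin u))

    colourable⇒AT : ∀ {k} s m → Colourable G k → 4 * k * m ≤ s → maxDegree G ≤ s + m →
                    HasATOrientation G (suc s)
    colourable⇒AT s m col km≤s Δ≤ = layered⇒AT G record
      { arc      = arc
      ; oriented = λ u v → trans (oriented u v) (trans (ℕ.*-identityˡ _) (ℕ.*-identityˡ _))
      ; rank     = rank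
      ; side     = side
      ; layered  = layered
      ; outs-≤   = outs-≤
      }
      where
      everything : PartialOrientation s (λ _ → true)
      everything = peel s (findLayer s m col km≤s λ W u → ℕ.≤-trans (deg-≤-degree W u)
                            (ℕ.≤-trans (degree-≤-maxDegree u) Δ≤))
                        _ (λ _ → true) ℕ.≤-refl
      open PartialOrientation everything

-- Choice of the parameters and passage to rational numbers.

module Bounds where

  open EulerianExpansion using (χP≤AT)
  open Peeling using (colourable⇒AT)
  open import Data.Integer.Base as ℤ using (ℤ; +≤+)
  import Data.Integer.Properties as ℤ
  open import Data.Integer.Tactic.RingSolver using () renaming (solve-∀ to ℤ-solve-∀)
  open import Data.Nat.Base using (ℕ; suc; _+_; _*_; _∸_; _≤_; _/_; _%_)
  open import Data.Nat.DivMod using (m/n*n≤m; m≡m%n+[m/n]*n; m%n<n)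
  import Data.Nat.Properties as ℕ
  open import Data.Nat.Tactic.RingSolver using (solve-∀)
  open import Data.Product.Base using (_×_; _,_; proj₁; proj₂)
  open import Data.Rational.Base as ℚ using (ℚ; 1ℚ; toℚᵘ; fromℚᵘ)
  import Data.Rational.Properties as ℚ
  open import Data.Rational.Unnormalised.Base as ℚᵘ using (ℚᵘ; mkℚᵘ; *≤*)
  import Data.Rational.Unnormalised.Properties as ℚᵘ
  open import Relation.Binary.PropositionalEquality using (_≡_; sym; trans; cong; cong₂; subst₂)

  -- The second argument of `mkℚᵘ` is the denominator minus one.
  integer : ℕ → ℚᵘ
  integer a = mkℚᵘ (ℤ.+ a) 0

  -- As 1 - 1/(x+1) = x/(x+1), the hypothesis is the claim multiplied by x + 1. Unnormalised
  -- rationals are compared by cross-multiplication in ℤ, and `toℚᵘ` respects the operations and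
  -- reflects the order.
  fraction-bound : ∀ x d a → a * suc x ≤ x * d + 2 * suc x →
    (ℤ.+ a) ℚ./ 1 ℚ.≤ (1ℚ ℚ.- (ℤ.+ 1) ℚ./ suc x) ℚ.* ((ℤ.+ d) ℚ./ 1) ℚ.+ (ℤ.+ 2) ℚ./ 1
  fraction-bound x d a le = ℚ.toℚᵘ-cancel-≤ (begin
    toℚᵘ (fromℚᵘ (integer a))        ≃⟨ ℚ.toℚᵘ-fromℚᵘ (integer a) ⟩
    integer a                        ≤⟨ *≤* (subst₂ ℤ._≤_ lhs rhs cast) ⟩
    (ℚᵘ.1ℚᵘ ℚᵘ.- mkℚᵘ (ℤ.+ 1) x) ℚᵘ.* integer d ℚᵘ.+ integer 2
      ≃⟨ ℚᵘ.+-cong (ℚᵘ.*-cong (ℚᵘ.+-cong (ℚᵘ.≃-refl {ℚᵘ.1ℚᵘ})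
           (ℚᵘ.≃-trans (ℚᵘ.-‿cong (ℚᵘ.≃-sym (ℚ.toℚᵘ-fromℚᵘ (mkℚᵘ (ℤ.+ 1) x)))) (ℚᵘ.≃-sym (ℚ.toℚᵘ-homo‿- y))))
           (ℚᵘ.≃-sym (ℚ.toℚᵘ-fromℚᵘ (integer d))))
           (ℚᵘ.≃-sym (ℚ.toℚᵘ-fromℚᵘ (integer 2))) ⟩
    (ℚᵘ.1ℚᵘ ℚᵘ.+ toℚᵘ (ℚ.- y)) ℚᵘ.* toℚᵘ (fromℚᵘ (integer d)) ℚᵘ.+ toℚᵘ (fromℚᵘ (integer 2))
      ≃⟨ ℚᵘ.+-cong (ℚᵘ.*-cong (ℚᵘ.≃-sym (ℚ.toℚᵘ-homo-+ 1ℚ (ℚ.- y))) ℚᵘ.≃-refl)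
           (ℚᵘ.≃-refl {toℚᵘ (fromℚᵘ (integer 2))}) ⟩
    toℚᵘ (1ℚ ℚ.- y) ℚᵘ.* toℚᵘ (fromℚᵘ (integer d)) ℚᵘ.+ toℚᵘ (fromℚᵘ (integer 2))
      ≃⟨ ℚᵘ.+-cong (ℚᵘ.≃-sym (ℚ.toℚᵘ-homo-* (1ℚ ℚ.- y) (fromℚᵘ (integer d))))
           (ℚᵘ.≃-refl {toℚᵘ (fromℚᵘ (integer 2))}) ⟩
    toℚᵘ ((1ℚ ℚ.- y) ℚ.* fromℚᵘ (integer d)) ℚᵘ.+ toℚᵘ (fromℚᵘ (integer 2))
      ≃⟨ ℚ.toℚᵘ-homo-+ ((1ℚ ℚ.- y) ℚ.* fromℚᵘ (integer d)) (fromℚᵘ (integer 2)) ⟨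
    toℚᵘ ((1ℚ ℚ.- y) ℚ.* fromℚᵘ (integer d) ℚ.+ fromℚᵘ (integer 2)) ∎)
    where
    open ℚᵘ.≤-Reasoning
    y = fromℚᵘ (mkℚᵘ (ℤ.+ 1) x)

    cast : ℤ.+ a ℤ.* ℤ.+ suc x ℤ.≤ ℤ.+ x ℤ.* ℤ.+ d ℤ.+ ℤ.+ 2 ℤ.* ℤ.+ suc x
    cast = subst₂ ℤ._≤_ (ℤ.pos-* a (suc x))
      (trans (ℤ.pos-+ (x * d) _) (cong₂ ℤ._+_ (ℤ.pos-* x d) (ℤ.pos-* 2 (suc x)))) (+≤+ le)

    -- The right-hand sides below are what the cross-multiplied form of _≤_ on ℚᵘ reduces to.
    lhs : ℤ.+ a ℤ.* ℤ.+ suc x ≡ ℤ.+ a ℤ.* ℤ.+ suc ((x + 0) * 1 * 1)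
    lhs = cong (λ y → ℤ.+ a ℤ.* ℤ.+ suc y) (arith x)
      where
      arith : ∀ x → x ≡ (x + 0) * 1 * 1
      arith = solve-∀

    rhs : ℤ.+ x ℤ.* ℤ.+ d ℤ.+ ℤ.+ 2 ℤ.* ℤ.+ suc x ≡
          (ℤ.+ (x + 0) ℤ.* ℤ.+ d ℤ.* ℤ.+ 1 ℤ.+ ℤ.+ 2 ℤ.* ℤ.+ suc ((x + 0) * 1)) ℤ.* ℤ.+ 1
    rhs = trans (arith (ℤ.+ x) (ℤ.+ suc x) (ℤ.+ d))
      (cong₂ (λ p q → (ℤ.+ p ℤ.* ℤ.+ d ℤ.* ℤ.+ 1 ℤ.+ ℤ.+ 2 ℤ.* ℤ.+ suc q) ℤ.* ℤ.+ 1)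
        (sym (ℕ.+-identityʳ x)) (arith′ x))
      where
      arith : ∀ x y d → x ℤ.* d ℤ.+ ℤ.+ 2 ℤ.* y ≡ (x ℤ.* d ℤ.* ℤ.+ 1 ℤ.+ ℤ.+ 2 ℤ.* y) ℤ.* ℤ.+ 1
      arith = ℤ-solve-∀

      arith′ : ∀ x → x ≡ (x + 0) * 1
      arith′ = solve-∀

  AT-bound : ∀ d r {n} (G : Graph n) → maxDegree G ≤ d → χ G ≤ r →
             AT G * suc (4 * r) ≤ 4 * r * d + 2 * suc (4 * r)
  AT-bound d r G Δ≤d χ≤r = begin
    AT G * N              ≤⟨ ℕ.*-monoˡ-≤ N (proj₂ (proj₂ (AT-least G)) (suc s)
                               -- If s exceeds d, the truncated difference is 0, and d ≤ s + (d ∸ s)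
                               -- still holds.
                               (colourable⇒AT G s (d ∸ s) (proj₁ (proj₂ (χ-least G))) sparse
                                 (ℕ.≤-trans Δ≤d (ℕ.m≤n+m∸n d s)))) ⟩
    suc s * N             ≡⟨ arith q N ⟩
    q * N + 2 * N         ≤⟨ ℕ.+-monoˡ-≤ (2 * N) (m/n*n≤m (4 * r * d) N) ⟩
    4 * r * d + 2 * N     ∎
    where
    open ℕ.≤-Reasoning
    N = suc (4 * r)
    q = 4 * r * d / N
    -- This unit rounds the quotient up, so that 4rd ≤ sN and thus 4r(d - s) ≤ s. The second unit,
    -- in `suc s`, comes from the strict bound on out-degrees; together they make the 2 of the
    -- theorem.
    s = suc q

    arith : ∀ q N → suc (suc q) * N ≡ q * N + 2 * N
    arith = solve-∀

    4rd≤sN : 4 * r * d ≤ s * N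
    4rd≤sN = begin
      4 * r * d                  ≡⟨ m≡m%n+[m/n]*n (4 * r * d) N ⟩
      4 * r * d % N + q * N      ≤⟨ ℕ.+-monoˡ-≤ (q * N) (ℕ.<⇒≤ (m%n<n (4 * r * d) N)) ⟩
      N + q * N                  ∎

    sparse : 4 * χ G * (d ∸ s) ≤ s
    sparse = begin
      4 * χ G * (d ∸ s)          ≤⟨ ℕ.*-monoˡ-≤ (d ∸ s) (ℕ.*-monoʳ-≤ 4 χ≤r) ⟩
      4 * r * (d ∸ s)            ≡⟨ ℕ.*-distribˡ-∸ (4 * r) d s ⟩
      4 * r * d ∸ 4 * r * s      ≤⟨ ℕ.m≤n+o⇒m∸n≤o (4 * r * d) (4 * r * s)
                                    (ℕ.≤-trans 4rd≤sN (ℕ.≤-reflexive (arith′ s (4 * r)))) ⟩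
      s                          ∎
      where
      arith′ : ∀ s x → s * suc x ≡ x * s + s
      arith′ = solve-∀

open import Data.Nat.Base as ℕ using (ℕ)
open import Data.Integer.Base using (+_)
open import Data.Rational.Base using (_/_; _≤_; _+_; _-_; _*_; 1ℚ)
open import Data.Product.Base using (_×_; _,_)

theorem1p2 : ∀ (d r : ℕ) → 2 ℕ.≤ r →
    ∀ {n : ℕ} (G : Graph n) → maxDegree G ℕ.≤ d → χ G ℕ.≤ r →
    (χP G ℕ.≤ AT G) ×
    ((+ AT G) / 1 ≤ (1ℚ - (+ 1) / (1 ℕ.+ 4 ℕ.* r)) * ((+ d) / 1) + (+ 2) / 1)
theorem1p2 d r _ G Δ≤d χ≤r = EulerianExpansion.χP≤AT G
  -- The denominator `1 ℕ.+ 4 ℕ.* r` reduces to `suc (4 ℕ.* r)`, so the bound applies as it stands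
  -- with x = 4r.
  , Bounds.fraction-bound (4 ℕ.* r) d (AT G) (Bounds.AT-bound d r G Δ≤d χ≤r)
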